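{- Let $n\ge 3$, let $F\subseteq E(K_n)$ be a set of $p\ge 1$ edges of the complete graph $K_n$, and assume that $K_n-F$ is connected. Then $$Kf(K_n-F)\ge n-1+\frac{2p}{n-2}.$$ Equality holds if and only if $H_F\cong pK_2$.
   Context: $K_n-F$ is the graph on the vertices of $K_n$ obtained by deleting the edges in $F$. The deletion graph of $F$ is $H_F=(V(F),F)$ with $V(F)=\bigcup_{e\in F}e$ (the set of endpoints of edges of $F$). $pK_2$ is the disjoint union of $p$ single edges. For a connected graph $G$ with Laplacian $L(G)=D(G)-A(G)$, the effective resistance between distinct vertices is $R_G(x,y)=(e_x-e_y)^TL(G)^+(e_x-e_y)$ ($L(G)^+$ the Moore--Penrose inverse, $e_x$ the standard basis vector of vertex $x$), and the Kirchhoff index is $Kf(G)=\sum_{\{x,y\}}R_G(x,y)$, the sum over all unordered pairs of distinct vertices. -}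

module Defs where

open import Data.Bool.Base using (if_then_else_)
import Data.Empty.Irrelevant
open import Data.Fin.Base as Fin using (Fin; zero; suc)
import Data.Fin.Properties as Fin
open import Data.List.Base using (List)
open import Data.List.Relation.Unary.Any using (Any; any?)
import Data.List.Relation.Unary.Any as Any
open import Data.Nat.Base using (ℕ; zero; suc)
open import Data.Product using (Σ; ∃; _×_; _,_; proj₁; proj₂)
open import Data.Rational using (ℚ; 0ℚ; 1ℚ; _+_; _*_; _-_; -_; 1/_; _≤_; ≢-nonZero; nonNegative; nonPositive)
open import Data.Rational.Properties
open import Data.Rational.Solver using (module +-*-Solver)
open import Data.Refinement using (Refinement; Refinement-syntax; value)
open import Data.Sum using (_⊎_; inj₁; inj₂)
open import Data.Vec.Functional using (Vector)
open import Function using (_↔_; _⇔_; _∘_)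
open import Function.Bundles using (module Inverse)
open import Level using (0ℓ)
open import Relation.Binary.Construct.Closure.ReflexiveTransitive using (Star)
open import Relation.Binary.Core using (Rel)
open import Relation.Binary.Definitions using (Decidable; Symmetric)
open import Relation.Binary.PropositionalEquality
open import Relation.Nullary using (Dec; ¬_; does; yes; no)
open import Relation.Nullary.Decidable using (¬?; _×-dec_; _⊎-dec_)

open import Algebra.Bundles using (CommutativeRing)
open import Algebra.Properties.Semiring.Sum (CommutativeRing.semiring +-*-commutativeRing) public
  using (sum; sum-cong-≗; ∑-distrib-+; ∑-comm; *-distribˡ-sum; *-distribʳ-sum)

------------------------------------------------------------------------
-- Rational vectors and matrices

-- All matrices that occur are rational, and the Moore–Penrose inverse of a
-- rational matrix is again rational: the matrix constructed below satisfies
-- the Penrose equations, which have at most one solution over ℝ.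

Matrix : ℕ → ℕ → Set
Matrix m n = Vector (Vector ℚ n) m

infix  4 _≋_
infixl 7 _·_ _⊗_ _⊛_
infix  8 _ᵀ

_≋_ : ∀ {m n} → Matrix m n → Matrix m n → Set
A ≋ B = ∀ i j → A i j ≡ B i j

_ᵀ : ∀ {m n} → Matrix m n → Matrix n m
(A ᵀ) i j = A j i

_·_ : ∀ {n} → Vector ℚ n → Vector ℚ n → ℚ
u · v = sum λ i → u i * v i

_⊛_ : ∀ {m n} → Matrix m n → Vector ℚ n → Vector ℚ m
(A ⊛ v) i = A i · v

_⊗_ : ∀ {l m n} → Matrix l m → Matrix m n → Matrix l n
(A ⊗ B) i k = A i · (B ᵀ) k

record IsMoorePenrose {m n} (A : Matrix m n) (M : Matrix n m) : Set where
  field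
    AMA≋A : (A ⊗ M) ⊗ A ≋ A
    MAM≋M : (M ⊗ A) ⊗ M ≋ M
    AMᵀ≋AM : (A ⊗ M) ᵀ ≋ A ⊗ M
    MAᵀ≋MA : (M ⊗ A) ᵀ ≋ M ⊗ A

------------------------------------------------------------------------
-- Existence of the Moore–Penrose inverse

·-cong : ∀ {n} {u u′ v v′ : Vector ℚ n} → u ≗ u′ → v ≗ v′ → u · v ≡ u′ · v′
·-cong p q = sum-cong-≗ λ i → cong₂ _*_ (p i) (q i)

·-comm : ∀ {n} (u v : Vector ℚ n) → u · v ≡ v · u
·-comm u v = sum-cong-≗ λ i → *-comm (u i) (v i)

·-linˡ : ∀ {n} (u : Vector ℚ n) c w v →
         (λ i → u i + c * w i) · v ≡ u · v + c * (w · v)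
·-linˡ u c w v = begin
  sum (λ i → (u i + c * w i) * v i)
    ≡⟨ sum-cong-≗ (λ i → lemma (u i) c (w i) (v i)) ⟩
  sum (λ i → u i * v i + c * (w i * v i))
    ≡⟨ ∑-distrib-+ (λ i → u i * v i) (λ i → c * (w i * v i)) ⟩
  u · v + sum (λ i → c * (w i * v i))
    ≡⟨ cong (u · v +_) (*-distribˡ-sum c (λ i → w i * v i)) ⟨
  u · v + c * (w · v) ∎
  where
  open ≡-Reasoning
  open +-*-Solver using (solve; con; _:=_; _:+_; _:*_; :-_)
  lemma : ∀ a b d e → (a + b * d) * e ≡ a * e + b * (d * e)
  lemma = solve 4 (λ a b d e → (a :+ b :* d) :* e := a :* e :+ b :* (d :* e)) refl

·-assoc : ∀ {m n} (u : Vector ℚ m) (M : Matrix m n) v →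
          (λ k → u · (M ᵀ) k) · v ≡ u · (M ⊛ v)
·-assoc u M v = begin
  sum (λ k → sum (λ j → u j * M j k) * v k)
    ≡⟨ sum-cong-≗ (λ k → *-distribʳ-sum (v k) (λ j → u j * M j k)) ⟩
  sum (λ k → sum (λ j → u j * M j k * v k))
    ≡⟨ ∑-comm (λ k j → u j * M j k * v k) ⟩
  sum (λ j → sum (λ k → u j * M j k * v k))
    ≡⟨ sum-cong-≗ (λ j → sum-cong-≗ (λ k → *-assoc (u j) (M j k) (v k))) ⟩
  sum (λ j → sum (λ k → u j * (M j k * v k)))
    ≡⟨ sum-cong-≗ (λ j → *-distribˡ-sum (u j) (λ k → M j k * v k)) ⟨
  sum (λ j → u j * sum (λ k → M j k * v k)) ∎
  where open ≡-Reasoning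

⊗-assoc : ∀ {k l m n} (A : Matrix k l) (B : Matrix l m) (C : Matrix m n) →
          (A ⊗ B) ⊗ C ≋ A ⊗ (B ⊗ C)
⊗-assoc A B C i j = ·-assoc (A i) B ((C ᵀ) j)

0≤p*p : ∀ p → 0ℚ ≤ p * p
0≤p*p p with ≤-total 0ℚ p
... | inj₁ 0≤p = nonNegative⁻¹ (p * p) {{nonNeg*nonNeg⇒nonNeg p {{nonNegative 0≤p}} p {{nonNegative 0≤p}}}}
... | inj₂ p≤0 = nonNegative⁻¹ (p * p) {{nonPos*nonPos⇒nonPos p {{nonPositive p≤0}} p {{nonPositive p≤0}}}}

p*p≡0⇒p≡0 : ∀ p → p * p ≡ 0ℚ → p ≡ 0ℚ
p*p≡0⇒p≡0 p pp≡0 with p ≟ 0ℚ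
... | yes p≡0 = p≡0
... | no p≢0 = begin
  p                ≡⟨ *-identityˡ p ⟨
  1ℚ * p           ≡⟨ cong (_* p) (*-inverseˡ p) ⟨
  (1/ p) * p * p   ≡⟨ *-assoc (1/ p) p p ⟩
  (1/ p) * (p * p) ≡⟨ cong ((1/ p) *_) pp≡0 ⟩
  (1/ p) * 0ℚ      ≡⟨ *-zeroʳ (1/ p) ⟩
  0ℚ               ∎
  where
  open ≡-Reasoning
  instance _ = ≢-nonZero p≢0

p+q≡0⇒p≡0 : ∀ p q → 0ℚ ≤ p → 0ℚ ≤ q → p + q ≡ 0ℚ → p ≡ 0ℚ
p+q≡0⇒p≡0 p q 0≤p 0≤q eq = ≤-antisym (begin
  p       ≡⟨ +-identityʳ p ⟨
  p + 0ℚ  ≤⟨ +-monoʳ-≤ p 0≤q ⟩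
  p + q   ≡⟨ eq ⟩
  0ℚ      ∎) 0≤p
  where open ≤-Reasoning

0≤v·v : ∀ {n} (v : Vector ℚ n) → 0ℚ ≤ v · v
0≤v·v {zero}  v = ≤-refl
0≤v·v {suc n} v = +-mono-≤ (0≤p*p (v zero)) (0≤v·v (v ∘ suc))

v·v≡0⇒v≡0 : ∀ {n} (v : Vector ℚ n) → v · v ≡ 0ℚ → ∀ i → v i ≡ 0ℚ
v·v≡0⇒v≡0 v eq zero =
  p*p≡0⇒p≡0 (v zero) (p+q≡0⇒p≡0 _ _ (0≤p*p (v zero)) (0≤v·v (v ∘ suc)) eq)
v·v≡0⇒v≡0 v eq (suc i) =
  v·v≡0⇒v≡0 (v ∘ suc)
    (p+q≡0⇒p≡0 _ _ (0≤v·v (v ∘ suc)) (0≤p*p (v zero)) (trans (+-comm ((v ∘ suc) · (v ∘ suc)) (v zero * v zero)) eq)) i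

normaliser : ∀ {n} (v : Vector ℚ n) → ∃ λ r → ∀ i → v i * (r * (v · v)) ≡ v i
normaliser v with v · v ≟ 0ℚ
... | yes vv≡0 = 0ℚ , λ i →
  trans (cong (_* (0ℚ * (v · v))) (v·v≡0⇒v≡0 v vv≡0 i))
        (trans (*-zeroˡ (0ℚ * (v · v))) (sym (v·v≡0⇒v≡0 v vv≡0 i)))
... | no vv≢0 = 1/ (v · v) , λ i →
  trans (cong (v i *_) (*-inverseˡ (v · v))) (*-identityʳ (v i))
  where instance _ = ≢-nonZero vv≢0

Projecting : ∀ {m n} → Matrix m n → Matrix n m → Set
Projecting A X = ((A ⊗ X) ⊗ A ≋ A) × ((A ⊗ X) ᵀ ≋ A ⊗ X)

-- By recursion on the columns A = [ a ∣ B ].  If X is given for B, the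
-- component c = a − B X a of a is orthogonal to the columns of B, and
-- P = B X is replaced by P + r c cᵀ, where r = 1 / ‖c‖² (or r = 0 if c = 0).
projecting : ∀ {m n} (A : Matrix m n) → ∃ (Projecting A)
projecting {m} {zero} A = (λ ()) , (λ _ ()) , (λ _ _ → refl)
projecting {m} {suc n} A = X′ , AX′A≋A , AX′ᵀ≋AX′
  where
  open ≡-Reasoning
  open +-*-Solver using (solve; con; _:=_; _:+_; _:*_; :-_)

  a : Vector ℚ m
  a i = A i zero

  B : Matrix m n
  B i j = A i (suc j)

  X : Matrix n m
  X = proj₁ (projecting B)

  P : Matrix m m
  P = B ⊗ X

  PB≋B : P ⊗ B ≋ B
  PB≋B = proj₁ (proj₂ (projecting B))

  Pᵀ≋P : P ᵀ ≋ P
  Pᵀ≋P = proj₂ (proj₂ (projecting B))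

  w : Vector ℚ n
  w = X ⊛ a

  c : Vector ℚ m
  c i = a i + - 1ℚ * (P ⊛ a) i

  r : ℚ
  r = proj₁ (normaliser c)

  b : Vector ℚ m
  b k = r * c k

  X′ : Matrix (suc n) m
  X′ zero    k = b k
  X′ (suc j) k = X j k + - b k * w j

  Pa≡Bw : ∀ i → (P ⊛ a) i ≡ (B ⊛ w) i
  Pa≡Bw i = ·-assoc (B i) X a

  c·B≡0 : ∀ j → c · (B ᵀ) j ≡ 0ℚ
  c·B≡0 j = begin
    c · (B ᵀ) j                                   ≡⟨ ·-linˡ a (- 1ℚ) (P ⊛ a) ((B ᵀ) j) ⟩
    a · (B ᵀ) j + - 1ℚ * ((P ⊛ a) · (B ᵀ) j)      ≡⟨ cong (λ z → a · (B ᵀ) j + - 1ℚ * z) Pa·B ⟩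
    a · (B ᵀ) j + - 1ℚ * (a · (B ᵀ) j)            ≡⟨ solve 1 (λ x → x :+ (:- con 1ℚ) :* x := con 0ℚ) refl (a · (B ᵀ) j) ⟩
    0ℚ ∎
    where
    Pa·B : (P ⊛ a) · (B ᵀ) j ≡ a · (B ᵀ) j
    Pa·B = begin
      (P ⊛ a) · (B ᵀ) j                ≡⟨ ·-cong (λ k → ·-comm (P k) a) (λ _ → refl) ⟩
      (λ k → a · P k) · (B ᵀ) j        ≡⟨ ·-assoc a (P ᵀ) ((B ᵀ) j) ⟩
      a · ((P ᵀ) ⊛ (B ᵀ) j)            ≡⟨ ·-cong {u = a} (λ _ → refl) (λ i → ·-cong (Pᵀ≋P i) (λ _ → refl)) ⟩
      a · (P ⊛ (B ᵀ) j)                ≡⟨ ·-cong {u = a} (λ _ → refl) (λ i → PB≋B i j) ⟩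
      a · (B ᵀ) j                      ∎

  c·Pa≡0 : c · (P ⊛ a) ≡ 0ℚ
  c·Pa≡0 = begin
    c · (P ⊛ a)                        ≡⟨ ·-cong {u = c} (λ _ → refl) Pa≡Bw ⟩
    c · (B ⊛ w)                        ≡⟨ ·-assoc c B w ⟨
    (λ k → c · (B ᵀ) k) · w            ≡⟨ sum-cong-≗ (λ k → trans (cong (_* w k) (c·B≡0 k)) (*-comm 0ℚ (w k))) ⟩
    sum (λ k → w k * 0ℚ)               ≡⟨ *-distribʳ-sum 0ℚ w ⟨
    sum w * 0ℚ                         ≡⟨ *-zeroʳ (sum w) ⟩
    0ℚ ∎

  c·a≡c·c : c · a ≡ c · c
  c·a≡c·c = begin
    c · a                                ≡⟨ ·-comm c a ⟩
    a · c                                ≡⟨ solve 1 (λ x → x := x :+ (:- con 1ℚ) :* con 0ℚ) refl (a · c) ⟩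
    a · c + - 1ℚ * 0ℚ                    ≡⟨ cong (λ z → a · c + - 1ℚ * z) (trans (·-comm (P ⊛ a) c) c·Pa≡0) ⟨
    a · c + - 1ℚ * ((P ⊛ a) · c)         ≡⟨ ·-linˡ a (- 1ℚ) (P ⊛ a) c ⟨
    c · c                                ∎

  AX′ : ∀ i k → (A ⊗ X′) i k ≡ P i k + c i * b k
  AX′ i k = begin
    a i * b k + B i · (λ j → X j k + - b k * w j)
      ≡⟨ cong (a i * b k +_) (trans (·-comm (B i) _) (·-linˡ ((X ᵀ) k) (- b k) w (B i))) ⟩
    a i * b k + ((X ᵀ) k · B i + - b k * (w · B i))
      ≡⟨ cong (a i * b k +_) (cong₂ (λ y z → y + - b k * z) (·-comm ((X ᵀ) k) (B i))
           (trans (·-comm w (B i)) (sym (Pa≡Bw i)))) ⟩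
    a i * b k + (P i k + - b k * (P ⊛ a) i)
      ≡⟨ solve 4 (λ x y p q → x :* y :+ (p :+ (:- y) :* q) := p :+ (x :+ (:- con 1ℚ) :* q) :* y)
           refl (a i) (b k) (P i k) ((P ⊛ a) i) ⟩
    P i k + c i * b k ∎

  AX′·v : ∀ i v → (A ⊗ X′) i · v ≡ P i · v + c i * (r * (c · v))
  AX′·v i v = begin
    (A ⊗ X′) i · v                       ≡⟨ ·-cong {v = v} (AX′ i) (λ _ → refl) ⟩
    (λ k → P i k + c i * b k) · v        ≡⟨ ·-linˡ (P i) (c i) b v ⟩
    P i · v + c i * (b · v)              ≡⟨ cong (λ z → P i · v + c i * z) b·v ⟩
    P i · v + c i * (r * (c · v))        ∎
    where
    b·v : b · v ≡ r * (c · v)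
    b·v = trans (sum-cong-≗ λ k → *-assoc r (c k) (v k))
                (sym (*-distribˡ-sum r (λ k → c k * v k)))

  AX′A≋A : (A ⊗ X′) ⊗ A ≋ A
  AX′A≋A i zero = begin
    (A ⊗ X′) i · a                       ≡⟨ AX′·v i a ⟩
    (P ⊛ a) i + c i * (r * (c · a))      ≡⟨ cong (λ z → (P ⊛ a) i + c i * (r * z)) c·a≡c·c ⟩
    (P ⊛ a) i + c i * (r * (c · c))      ≡⟨ cong ((P ⊛ a) i +_) (proj₂ (normaliser c) i) ⟩
    (P ⊛ a) i + c i                      ≡⟨ solve 2 (λ p x → p :+ (x :+ (:- con 1ℚ) :* p) := x) refl ((P ⊛ a) i) (a i) ⟩
    a i                                  ∎
  AX′A≋A i (suc j) = begin
    (A ⊗ X′) i · (B ᵀ) j                 ≡⟨ AX′·v i ((B ᵀ) j) ⟩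
    (P ⊗ B) i j + c i * (r * (c · (B ᵀ) j))
                                         ≡⟨ cong₂ (λ y z → y + c i * (r * z)) (PB≋B i j) (c·B≡0 j) ⟩
    B i j + c i * (r * 0ℚ)               ≡⟨ solve 3 (λ x y z → x :+ y :* (z :* con 0ℚ) := x) refl (B i j) (c i) r ⟩
    B i j                                ∎

  AX′ᵀ≋AX′ : (A ⊗ X′) ᵀ ≋ A ⊗ X′
  AX′ᵀ≋AX′ i k = begin
    (A ⊗ X′) k i                         ≡⟨ AX′ k i ⟩
    P k i + c k * (r * c i)              ≡⟨ cong₂ _+_ (Pᵀ≋P i k)
                                              (solve 3 (λ x y z → x :* (y :* z) := z :* (y :* x)) refl (c k) r (c i)) ⟩
    P i k + c i * (r * c k)              ≡⟨ AX′ i k ⟨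
    (A ⊗ X′) i k                         ∎

-- A⁺ = Zᵀ A X, where A X and A ᵀ Z are the orthogonal projections onto the
-- column spaces of A and A ᵀ.
moorePenrose : ∀ {m n} (A : Matrix m n) → ∃ (IsMoorePenrose A)
moorePenrose {m} {n} A = M , record
  { AMA≋A  = λ i j → trans (·-cong (AM≋AX i) (λ _ → refl)) (AXA i j)
  ; MAM≋M  = MAM
  ; AMᵀ≋AM = λ i j → trans (AM≋AX j i) (trans (AXᵀ i j) (sym (AM≋AX i j)))
  ; MAᵀ≋MA = λ i j → trans (MA≋YA j i) (trans (YAᵀ i j) (sym (MA≋YA i j)))
  }
  where
  open ≡-Reasoning

  X Y M : Matrix n m
  X = proj₁ (projecting A)
  Y = proj₁ (projecting (A ᵀ)) ᵀ
  M = Y ⊗ (A ⊗ X)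

  AXA : (A ⊗ X) ⊗ A ≋ A
  AXA = proj₁ (proj₂ (projecting A))

  AXᵀ : (A ⊗ X) ᵀ ≋ A ⊗ X
  AXᵀ = proj₂ (proj₂ (projecting A))

  [AᵀYᵀ]ᵀ : ∀ i j → ((A ᵀ) ⊗ (Y ᵀ)) j i ≡ (Y ⊗ A) i j
  [AᵀYᵀ]ᵀ i j = ·-comm ((A ᵀ) j) (Y i)

  YAᵀ : (Y ⊗ A) ᵀ ≋ Y ⊗ A
  YAᵀ i j = begin
    (Y ⊗ A) j i                ≡⟨ [AᵀYᵀ]ᵀ j i ⟨
    ((A ᵀ) ⊗ (Y ᵀ)) i j        ≡⟨ proj₂ (proj₂ (projecting (A ᵀ))) i j ⟨
    ((A ᵀ) ⊗ (Y ᵀ)) j i        ≡⟨ [AᵀYᵀ]ᵀ i j ⟩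
    (Y ⊗ A) i j                ∎

  AYA : A ⊗ (Y ⊗ A) ≋ A
  AYA i j = begin
    A i · (λ k → (Y ⊗ A) k j)            ≡⟨ ·-comm (A i) _ ⟩
    (λ k → (Y ⊗ A) k j) · A i            ≡⟨ ·-cong {v = A i} (λ k → [AᵀYᵀ]ᵀ k j) (λ _ → refl) ⟨
    (((A ᵀ) ⊗ (Y ᵀ)) ⊗ (A ᵀ)) j i        ≡⟨ proj₁ (proj₂ (projecting (A ᵀ))) j i ⟩
    A i j                                ∎

  AM≋AX : A ⊗ M ≋ A ⊗ X
  AM≋AX i j = begin
    (A ⊗ (Y ⊗ (A ⊗ X))) i j              ≡⟨ ·-cong {u = A i} (λ _ → refl) (λ k → ⊗-assoc Y A X k j) ⟨
    (A ⊗ ((Y ⊗ A) ⊗ X)) i j              ≡⟨ ⊗-assoc A (Y ⊗ A) X i j ⟨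
    ((A ⊗ (Y ⊗ A)) ⊗ X) i j              ≡⟨ ·-cong (AYA i) (λ _ → refl) ⟩
    (A ⊗ X) i j                          ∎

  MA≋YA : M ⊗ A ≋ Y ⊗ A
  MA≋YA i j = begin
    ((Y ⊗ (A ⊗ X)) ⊗ A) i j              ≡⟨ ⊗-assoc Y (A ⊗ X) A i j ⟩
    (Y ⊗ ((A ⊗ X) ⊗ A)) i j              ≡⟨ ·-cong {u = Y i} (λ _ → refl) (λ k → AXA k j) ⟩
    (Y ⊗ A) i j                          ∎

  MAM : (M ⊗ A) ⊗ M ≋ M
  MAM i j = begin
    ((M ⊗ A) ⊗ M) i j                    ≡⟨ ⊗-assoc M A M i j ⟩
    (M ⊗ (A ⊗ M)) i j                    ≡⟨ ·-cong {u = M i} (λ _ → refl) (λ k → AM≋AX k j) ⟩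
    (M ⊗ (A ⊗ X)) i j                    ≡⟨ ⊗-assoc M A X i j ⟨
    ((M ⊗ A) ⊗ X) i j                    ≡⟨ ·-cong {v = (X ᵀ) j} (MA≋YA i) (λ _ → refl) ⟩
    ((Y ⊗ A) ⊗ X) i j                    ≡⟨ ⊗-assoc Y A X i j ⟩
    M i j                                ∎

infix 8 _⁺

-- Opaque because the Penrose equations characterise A ⁺ and unfolding the
-- construction makes conversion checking expensive.
opaque
  _⁺ : ∀ {m n} → Matrix m n → Matrix n m
  A ⁺ = proj₁ (moorePenrose A)

  ⁺-isMoorePenrose : ∀ {m n} (A : Matrix m n) → IsMoorePenrose A (A ⁺)
  ⁺-isMoorePenrose A = proj₂ (moorePenrose A)

------------------------------------------------------------------------
-- Simple graphs

record Graph (V : Set) : Set₁ where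
  field
    Adj         : Rel V 0ℓ
    adj?        : Decidable Adj
    symmetric   : Symmetric Adj
    irreflexive : ∀ {v} → ¬ Adj v v

open Graph using (Adj; adj?)

K : (n : ℕ) → Graph (Fin n)
K n = record
  { Adj         = _≢_
  ; adj?        = λ x y → ¬? (x Fin.≟ y)
  ; symmetric   = ≢-sym
  ; irreflexive = λ x≢x → x≢x refl
  }

-- k copies G is the disjoint union of k copies of G.
infixr 7 _copies_

_copies_ : ∀ {V} (k : ℕ) → Graph V → Graph (Fin k × V)
k copies G = record
  { Adj         = λ (i , u) (j , v) → i ≡ j × Adj G u v
  ; adj?        = λ (i , u) (j , v) → i Fin.≟ j ×-dec adj? G u v
  ; symmetric   = λ (i≡j , uv) → sym i≡j , Graph.symmetric G uv
  ; irreflexive = λ (_ , uu) → Graph.irreflexive G uu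
  }

Connected : ∀ {V} → Graph V → Set
Connected G = ∀ x y → Star (Adj G) x y

infix 4 _≅_

_≅_ : ∀ {V W} → Graph V → Graph W → Set
_≅_ {V} {W} G H = Σ (V ↔ W) λ f →
  ∀ x y → Adj G x y ⇔ Adj H (Inverse.to f x) (Inverse.to f y)

------------------------------------------------------------------------
-- Edges of the complete graph, edge deletion and the deletion graph

-- An edge {x , y} is represented once, with its smaller endpoint first.
record Edge (n : ℕ) : Set where
  constructor edge
  field
    fst snd  : Fin n
    .fst<snd : fst Fin.< snd

open Edge using (fst; snd)

_Joins_and_ : ∀ {n} → Edge n → Fin n → Fin n → Set
e Joins x and y = (fst e ≡ x × snd e ≡ y) ⊎ (fst e ≡ y × snd e ≡ x)

joins? : ∀ {n} x y (e : Edge n) → Dec (e Joins x and y)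
joins? x y e = (fst e Fin.≟ x ×-dec snd e Fin.≟ y) ⊎-dec (fst e Fin.≟ y ×-dec snd e Fin.≟ x)

_EndpointOf_ : ∀ {n} → Fin n → Edge n → Set
x EndpointOf e = fst e ≡ x ⊎ snd e ≡ x

Linked : ∀ {n} → List (Edge n) → Rel (Fin n) 0ℓ
Linked F x y = Any (_Joins x and y) F

linked? : ∀ {n} (F : List (Edge n)) → Decidable (Linked F)
linked? F x y = any? (joins? x y) F

linked-sym : ∀ {n} (F : List (Edge n)) → Symmetric (Linked F)
linked-sym F = Any.map λ { (inj₁ p) → inj₂ p ; (inj₂ p) → inj₁ p }

linked-irrefl : ∀ {n} (F : List (Edge n)) {x} → ¬ Linked F x x
linked-irrefl F p with Any.satisfied p
... | edge _ _ x<x , inj₁ (refl , refl) = Data.Empty.Irrelevant.⊥-elim (Fin.<-irrefl refl x<x)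
... | edge _ _ x<x , inj₂ (refl , refl) = Data.Empty.Irrelevant.⊥-elim (Fin.<-irrefl refl x<x)

infixl 6 _∖_

_∖_ : ∀ {n} → Graph (Fin n) → List (Edge n) → Graph (Fin n)
G ∖ F = record
  { Adj         = λ x y → Adj G x y × ¬ Linked F x y
  ; adj?        = λ x y → adj? G x y ×-dec ¬? (linked? F x y)
  ; symmetric   = λ (xy , ¬xy) → Graph.symmetric G xy , ¬xy ∘ linked-sym F
  ; irreflexive = λ (xx , _) → Graph.irreflexive G xx
  }

V⟨_⟩ : ∀ {n} → List (Edge n) → Set
V⟨_⟩ {n} F = [ x ∈ Fin n ∣ Any (x EndpointOf_) F ]

H : ∀ {n} (F : List (Edge n)) → Graph V⟨ F ⟩
H F = record
  { Adj         = λ x y → Linked F (value x) (value y)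
  ; adj?        = λ x y → linked? F (value x) (value y)
  ; symmetric   = linked-sym F
  ; irreflexive = linked-irrefl F
  }

------------------------------------------------------------------------
-- Laplacian, effective resistance and Kirchhoff index

module _ {n} (G : Graph (Fin n)) where

  adjacency : Matrix n n
  adjacency x y = if does (adj? G x y) then 1ℚ else 0ℚ

  degree : Fin n → ℚ
  degree x = sum (adjacency x)

  degreeMatrix : Matrix n n
  degreeMatrix x y = if does (x Fin.≟ y) then degree x else 0ℚ

  laplacian : Matrix n n
  laplacian x y = degreeMatrix x y - adjacency x y

basis : ∀ {n} → Fin n → Vector ℚ n
basis x y = if does (x Fin.≟ y) then 1ℚ else 0ℚ

resistance : ∀ {n} → Graph (Fin n) → Fin n → Fin n → ℚ
resistance G x y = d · (laplacian G ⁺ ⊛ d)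
  where d = λ z → basis x z - basis y z

-- Each unordered pair {x , y} is counted once, as x < y.
kirchhoffIndex : ∀ {n} → Graph (Fin n) → ℚ
kirchhoffIndex G = sum λ x → sum λ y →
  if does (x Fin.<? y) then resistance G x y else 0ℚ

{-# OPTIONS --safe #-}

-- Write G = Kₙ − F, R for effective resistance in G, and L for its Laplacian.
-- Since L L⁺ = I − J/n, Foster's theorem gives Σ R(x,y) = n − 1 over the edges
-- of G, so Kf(G) is n − 1 plus the sum of R over the deleted edges.  For a
-- deleted edge {x,y}, let d = e_x − e_y, L w = d and t = 1/(n−2); nonnegativity of
-- the quadratic form of L at w − t d gives
--   R(x,y) ≥ 2t + t² (d_F(x) − 1 + d_F(y) − 1) ≥ 2t,
-- where d_F is the degree in the deletion graph.  If all these are equalities,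
-- then d_F ≤ 1 throughout, so F is a matching; conversely, for a matching d is an
-- eigenvector of L with eigenvalue n − 2, whence R(x,y) = 2t.
module Submission where

open import Defs
import Data.Empty.Irrelevant
open import Data.Bool.Base using (if_then_else_)
open import Data.Fin.Base as Fin using (Fin; zero; suc)
import Data.Fin.Properties as Fin
import Data.Integer.Properties as ℤ
open import Data.Irrelevant using ([_])
open import Data.List.Base using (List; []; _∷_; length; lookup)
open import Data.List.Membership.Propositional using (lose)
open import Data.List.Membership.Propositional.Properties using (∈-lookup)
import Data.List.Relation.Unary.All as All
open import Data.List.Relation.Unary.AllPairs using ([]; _∷_)
open import Data.List.Relation.Unary.Any as Any using (Any; any?)
open import Data.List.Relation.Unary.Any.Properties using (lookup-index)
open import Data.List.Relation.Unary.Unique.Propositional using (Unique)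
open import Data.Nat.Base as ℕ using (ℕ; _∸_; >-nonZero; zero; suc)
import Data.Nat.Properties as ℕ
open import Data.Nat.Properties using (m<n⇒0<n∸m)
open import Data.Product using (_×_; _,_; proj₁; proj₂; ∃)
open import Data.Rational using
  (ℚ; 0ℚ; 1ℚ; _/_; _+_; _*_; _-_; -_; _≤_; Positive; nonNegative; toℚᵘ; fromℚᵘ)
open import Data.Rational.Properties
open import Data.Rational.Solver using (module +-*-Solver)
open import Data.Rational.Unnormalised as ℚᵘ using (mkℚᵘ; *≡*)
import Data.Rational.Unnormalised.Properties as ℚᵘ
open import Data.Refinement using (value; _,_)
open import Data.Refinement.Properties using (value-injective)
open import Data.Sum using (inj₁; inj₂)
open import Data.Vec.Functional using (Vector)
open import Function using
  (_⇔_; _↔_; mk⇔; mk↔ₛ′; _∘_; module Inverse; module Equivalence)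
open import Relation.Binary.Construct.Closure.ReflexiveTransitive using (Star; ε; _◅_)
open import Relation.Binary.Definitions using (Tri; tri<; tri≈; tri>)
open import Relation.Binary.PropositionalEquality hiding (J)
open import Relation.Nullary using (Dec; ¬_; does; yes; no; contradiction)
open import Relation.Nullary.Decidable using
  (_×-dec_; _⊎-dec_; from-no; recompute; dec-true; dec-false; does-⇔)

open +-*-Solver using (solve; con; _:=_; _:+_; _:*_; _:-_; :-_)
open Graph using (Adj; adj?)
open Edge using (fst; snd)

-- Indicators of decidable propositions, and order on the rationals.

indicator : ∀ {P : Set} → Dec P → ℚ
indicator P? = if does P? then 1ℚ else 0ℚ

indicator-yes : ∀ {P : Set} (P? : Dec P) → P → indicator P? ≡ 1ℚ
indicator-yes P? p = cong (if_then 1ℚ else 0ℚ) (dec-true P? p)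

indicator-no : ∀ {P : Set} (P? : Dec P) → ¬ P → indicator P? ≡ 0ℚ
indicator-no P? ¬p = cong (if_then 1ℚ else 0ℚ) (dec-false P? ¬p)

indicator-⇔ : ∀ {P Q : Set} (P? : Dec P) (Q? : Dec Q) → P ⇔ Q → indicator P? ≡ indicator Q?
indicator-⇔ P? Q? P⇔Q = cong (if_then 1ℚ else 0ℚ) (does-⇔ P⇔Q P? Q?)

0≤indicator : ∀ {P : Set} (P? : Dec P) → 0ℚ ≤ indicator P?
0≤indicator (yes _) = nonNegative⁻¹ 1ℚ
0≤indicator (no _) = ≤-refl

p≤q⇒0≤q-p : ∀ {p q} → p ≤ q → 0ℚ ≤ q - p
p≤q⇒0≤q-p {p} {q} p≤q = subst (_≤ q - p) (+-inverseʳ p) (+-monoˡ-≤ (- p) p≤q)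

0≤q-p⇒p≤q : ∀ {p q} → 0ℚ ≤ q - p → p ≤ q
0≤q-p⇒p≤q {p} {q} 0≤q-p = subst₂ _≤_ (+-identityˡ p)
  (solve 2 (λ p q → q :- p :+ p := q) refl p q) (+-monoˡ-≤ p 0≤q-p)

0≤p*q : ∀ {p q} → 0ℚ ≤ p → 0ℚ ≤ q → 0ℚ ≤ p * q
0≤p*q {p} {q} 0≤p 0≤q = nonNegative⁻¹ (p * q)
  {{nonNeg*nonNeg⇒nonNeg p {{nonNegative 0≤p}} q {{nonNegative 0≤q}}}}

-- Finite sums

sum-mono : ∀ {n} {u v : Vector ℚ n} → (∀ i → u i ≤ v i) → sum u ≤ sum v
sum-mono {zero}  u≤v = ≤-refl
sum-mono {suc n} u≤v = +-mono-≤ (u≤v zero) (sum-mono (u≤v ∘ suc))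

sum-zero : ∀ n → sum {n} (λ _ → 0ℚ) ≡ 0ℚ
sum-zero zero    = refl
sum-zero (suc n) = trans (+-identityˡ _) (sum-zero n)

0≤sum : ∀ {n} {u : Vector ℚ n} → (∀ i → 0ℚ ≤ u i) → 0ℚ ≤ sum u
0≤sum {n} {u} 0≤u = subst (_≤ sum u) (sum-zero n) (sum-mono 0≤u)

sum≡0⇒≡0 : ∀ {n} {u : Vector ℚ n} → (∀ i → 0ℚ ≤ u i) → sum u ≡ 0ℚ → ∀ i → u i ≡ 0ℚ
sum≡0⇒≡0 {suc n} {u} 0≤u eq zero =
  p+q≡0⇒p≡0 _ _ (0≤u zero) (0≤sum (0≤u ∘ suc)) eq
sum≡0⇒≡0 {suc n} {u} 0≤u eq (suc i) =
  sum≡0⇒≡0 (0≤u ∘ suc) (p+q≡0⇒p≡0 _ _ (0≤sum (0≤u ∘ suc)) (0≤u zero)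
    (trans (+-comm (sum (u ∘ suc)) (u zero)) eq)) i

sum-distrib-- : ∀ {n} (u v : Vector ℚ n) → sum (λ i → u i - v i) ≡ sum u - sum v
sum-distrib-- {zero}  u v = refl
sum-distrib-- {suc n} u v = trans (cong ((u zero - v zero) +_) (sum-distrib-- (u ∘ suc) (v ∘ suc)))
  (solve 4 (λ a b c d → a :- b :+ (c :- d) := a :+ c :- (b :+ d)) refl
    (u zero) (v zero) (sum (u ∘ suc)) (sum (v ∘ suc)))

u·0≡0 : ∀ {n} (u v : Vector ℚ n) → (∀ x → v x ≡ 0ℚ) → u · v ≡ 0ℚ
u·0≡0 {n} u v v≡0 = trans (sum-cong-≗ λ x → trans (cong (u x *_) (v≡0 x)) (*-zeroʳ (u x))) (sum-zero n)

basis·v≡v : ∀ {n} (x : Fin n) v → basis x · v ≡ v x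
basis·v≡v {suc n} zero v = trans
  (cong₂ _+_ (*-identityˡ (v zero)) (trans (sum-cong-≗ λ i → *-zeroˡ (v (suc i))) (sum-zero n)))
  (+-identityʳ (v zero))
basis·v≡v (suc x) v = trans (cong₂ _+_ (*-zeroˡ (v zero)) (basis·v≡v x (v ∘ suc))) (+-identityˡ _)

sum-basis : ∀ {n} (x : Fin n) → sum (basis x) ≡ 1ℚ
sum-basis x = trans (sum-cong-≗ λ i → sym (*-identityʳ (basis x i))) (basis·v≡v x (λ _ → 1ℚ))

basis-sym : ∀ {n} (x y : Fin n) → basis x y ≡ basis y x
basis-sym x y = indicator-⇔ (x Fin.≟ y) (y Fin.≟ x) (mk⇔ sym sym)

basis-refl : ∀ {n} (x : Fin n) → basis x x ≡ 1ℚ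
basis-refl x = indicator-yes (x Fin.≟ x) refl

basis-≢ : ∀ {n} {x y : Fin n} → x ≢ y → basis x y ≡ 0ℚ
basis-≢ {x = x} {y} = indicator-no (x Fin.≟ y)

·-distribʳ-- : ∀ {n} (u v w : Vector ℚ n) → (λ i → u i - v i) · w ≡ u · w - v · w
·-distribʳ-- u v w = trans
  (sum-cong-≗ λ i → solve 3 (λ a b c → (a :- b) :* c := a :* c :- b :* c) refl (u i) (v i) (w i))
  (sum-distrib-- (λ i → u i * w i) (λ i → v i * w i))

[basis-basis]·v : ∀ {n} (x y : Fin n) v → (λ z → basis x z - basis y z) · v ≡ v x - v y
[basis-basis]·v x y v = trans (·-distribʳ-- (basis x) (basis y) v)
  (cong₂ _-_ (basis·v≡v x v) (basis·v≡v y v))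

-- Sums over all entries of a square matrix.

total : ∀ {n} → Matrix n n → ℚ
total A = sum λ x → sum (A x)

total-cong : ∀ {n} {A B : Matrix n n} → A ≋ B → total A ≡ total B
total-cong A≋B = sum-cong-≗ λ x → sum-cong-≗ (A≋B x)

total-zero : ∀ n → total {n} (λ _ _ → 0ℚ) ≡ 0ℚ
total-zero n = trans (sum-cong-≗ {n} λ _ → sum-zero n) (sum-zero n)

total-+ : ∀ {n} (A B : Matrix n n) → total (λ x y → A x y + B x y) ≡ total A + total B
total-+ A B = trans (sum-cong-≗ λ x → ∑-distrib-+ (A x) (B x))
  (∑-distrib-+ (λ x → sum (A x)) (λ x → sum (B x)))

*-distribˡ-total : ∀ {n} c (A : Matrix n n) → c * total A ≡ total (λ x y → c * A x y)
*-distribˡ-total c A = trans (*-distribˡ-sum c (λ x → sum (A x)))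
  (sum-cong-≗ λ x → *-distribˡ-sum c (A x))

-- Sums over edges or unordered pairs are handled as doubled sums over ordered pairs, so that no
-- halving occurs; this is the passage between the two forms.
total-symmetrise : ∀ {n} (A : Matrix n n) → total A + total A ≡ total (λ x y → A x y + A y x)
total-symmetrise A = trans (cong (total A +_) (∑-comm A)) (sym (total-+ A (A ᵀ)))

0≤total : ∀ {n} (A : Matrix n n) → (∀ x y → 0ℚ ≤ A x y) → 0ℚ ≤ total A
0≤total A 0≤A = 0≤sum λ x → 0≤sum (0≤A x)

total≡0⇒≡0 : ∀ {n} (A : Matrix n n) → (∀ x y → 0ℚ ≤ A x y) → total A ≡ 0ℚ → ∀ x y → A x y ≡ 0ℚ
total≡0⇒≡0 A 0≤A eq x = sum≡0⇒≡0 (0≤A x) (sum≡0⇒≡0 (λ x → 0≤sum (0≤A x)) eq x)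

-- The Laplacian

module _ {n} (G : Graph (Fin n)) where

  private
    a L : Matrix n n
    a = adjacency G
    L = laplacian G

  adjacency-sym : ∀ x y → a x y ≡ a y x
  adjacency-sym x y = indicator-⇔ (adj? G x y) (adj? G y x)
    (mk⇔ (Graph.symmetric G) (Graph.symmetric G))

  laplacian-entry : ∀ x y → L x y ≡ degree G x * basis x y - a x y
  laplacian-entry x y with x Fin.≟ y
  ... | yes _ = cong (_- a x y) (sym (*-identityʳ (degree G x)))
  ... | no _  = cong (_- a x y) (sym (*-zeroʳ (degree G x)))

  laplacian-sym : ∀ x y → L x y ≡ L y x
  laplacian-sym x y = by-cases (x Fin.≟ y)
    where
    open ≡-Reasoning
    by-cases : Dec (x ≡ y) → L x y ≡ L y x
    by-cases (yes refl) = refl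
    by-cases (no x≢y) = begin
      L x y                            ≡⟨ laplacian-entry x y ⟩
      degree G x * basis x y - a x y   ≡⟨ cong₂ (λ b c → degree G x * b - c) (basis-≢ x≢y) (adjacency-sym x y) ⟩
      degree G x * 0ℚ - a y x          ≡⟨ cong (_- a y x) (trans (*-zeroʳ (degree G x)) (sym (*-zeroʳ (degree G y)))) ⟩
      degree G y * 0ℚ - a y x          ≡⟨ cong (λ b → degree G y * b - a y x) (basis-≢ (≢-sym x≢y)) ⟨
      degree G y * basis y x - a y x   ≡⟨ laplacian-entry y x ⟨
      L y x                            ∎

  -- The degree of `x` is the sum of row `x` of the adjacency matrix, so the diagonal term
  -- `degree G x * v x` can be spread over the neighbours of `x`.
  laplacian-⊛ : ∀ v x → (L ⊛ v) x ≡ sum λ y → a x y * (v x - v y)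
  laplacian-⊛ v x = begin
    sum (λ y → L x y * v y)
      ≡⟨ sum-cong-≗ (λ y → trans (cong (_* v y) (laplacian-entry x y))
           (solve 4 (λ d b c w → (d :* b :- c) :* w := d :* (b :* w) :- c :* w) refl
             (degree G x) (basis x y) (a x y) (v y))) ⟩
    sum (λ y → degree G x * (basis x y * v y) - a x y * v y)
      ≡⟨ sum-distrib-- (λ y → degree G x * (basis x y * v y)) (λ y → a x y * v y) ⟩
    sum (λ y → degree G x * (basis x y * v y)) - a x · v
      ≡⟨ cong (_- a x · v) (trans (sym (*-distribˡ-sum (degree G x) (λ y → basis x y * v y)))
           (cong (degree G x *_) (basis·v≡v x v))) ⟩
    degree G x * v x - a x · v
      ≡⟨ cong (_- a x · v) (*-distribʳ-sum (v x) (a x)) ⟩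
    sum (λ y → a x y * v x) - a x · v
      ≡⟨ sum-distrib-- (λ y → a x y * v x) (λ y → a x y * v y) ⟨
    sum (λ y → a x y * v x - a x y * v y)
      ≡⟨ sum-cong-≗ (λ y → solve 3 (λ c p q → c :* p :- c :* q := c :* (p :- q)) refl (a x y) (v x) (v y)) ⟩
    sum (λ y → a x y * (v x - v y)) ∎
    where open ≡-Reasoning

  -- The summand of the polarised Dirichlet form. Summation over ordered pairs counts each edge
  -- twice.
  energyDensity : Vector ℚ n → Vector ℚ n → Matrix n n
  energyDensity u v x y = a x y * ((u x - u y) * (v x - v y))

  energy : Vector ℚ n → Vector ℚ n → ℚ
  energy u v = total (energyDensity u v)

  -- Summation by parts: exchanging the names of the two ends of each edge and adding turns `u x`
  -- into the difference `u x - u y`.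
  u·Lv+u·Lv≡energy : ∀ u v → u · (L ⊛ v) + u · (L ⊛ v) ≡ energy u v
  u·Lv+u·Lv≡energy u v = begin
    u · (L ⊛ v) + u · (L ⊛ v)
      ≡⟨ cong₂ _+_ u·Lv u·Lv ⟩
    total S + total S
      ≡⟨ total-symmetrise S ⟩
    total (λ x y → S x y + S y x)
      ≡⟨ total-cong (λ x y → trans (cong (λ c → S x y + u y * (c * (v y - v x))) (adjacency-sym y x))
           (solve 5 (λ p q c r s → p :* (c :* (r :- s)) :+ q :* (c :* (s :- r)) := c :* ((p :- q) :* (r :- s)))
             refl (u x) (u y) (a x y) (v x) (v y))) ⟩
    energy u v ∎
    where
    open ≡-Reasoning
    S : Matrix n n
    S x y = u x * (a x y * (v x - v y))
    u·Lv : u · (L ⊛ v) ≡ total S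
    u·Lv = sum-cong-≗ λ x → trans (cong (u x *_) (laplacian-⊛ v x))
      (*-distribˡ-sum (u x) (λ y → a x y * (v x - v y)))

  laplacian-selfAdjoint : ∀ u v → u · (L ⊛ v) ≡ v · (L ⊛ u)
  laplacian-selfAdjoint u v = begin
    u · (L ⊛ v)                     ≡⟨ ·-assoc u L v ⟨
    (λ k → u · (L ᵀ) k) · v         ≡⟨ ·-cong {v = v} (λ k → trans (·-comm u ((L ᵀ) k))
                                         (·-cong {v = u} (λ j → laplacian-sym j k) (λ _ → refl))) (λ _ → refl) ⟩
    (L ⊛ u) · v                     ≡⟨ ·-comm (L ⊛ u) v ⟩
    v · (L ⊛ u)                     ∎
    where open ≡-Reasoning

  0≤energyDensity : ∀ v x y → 0ℚ ≤ energyDensity v v x y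
  0≤energyDensity v x y = 0≤p*q (0≤indicator (adj? G x y)) (0≤p*p (v x - v y))

  laplacian-nonNegative : ∀ v → 0ℚ ≤ v · (L ⊛ v)
  laplacian-nonNegative v = *-cancelˡ-≤-pos 2ℚ (begin
    2ℚ * 0ℚ                    ≡⟨ *-zeroʳ 2ℚ ⟩
    0ℚ                         ≤⟨ 0≤total (energyDensity v v) (0≤energyDensity v) ⟩
    energy v v                 ≡⟨ u·Lv+u·Lv≡energy v v ⟨
    v · (L ⊛ v) + v · (L ⊛ v)  ≡⟨ solve 1 (λ p → p :+ p := con 2ℚ :* p) refl (v · (L ⊛ v)) ⟩
    2ℚ * (v · (L ⊛ v))         ∎)
    where
    open ≤-Reasoning
    2ℚ = 1ℚ + 1ℚ

  -- The energy of `v` vanishes and is a sum of nonnegative terms, so `v` agrees at the ends of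
  -- every edge and hence along every path.
  harmonic⇒constant : Connected G → ∀ v → (∀ x → (L ⊛ v) x ≡ 0ℚ) → ∀ x y → v x ≡ v y
  harmonic⇒constant connected v Lv≡0 x y = along (connected x y)
    where
    energy≡0 : energy v v ≡ 0ℚ
    energy≡0 = trans (sym (u·Lv+u·Lv≡energy v v))
      (cong₂ _+_ (u·0≡0 v (L ⊛ v) Lv≡0) (u·0≡0 v (L ⊛ v) Lv≡0))

    step : ∀ {x y} → Adj G x y → v x ≡ v y
    step {x} {y} xy = p-q≡0⇒p≡q (v x) (v y) (p*p≡0⇒p≡0 (v x - v y) (begin
      (v x - v y) * (v x - v y)            ≡⟨ *-identityˡ _ ⟨
      1ℚ * ((v x - v y) * (v x - v y))     ≡⟨ cong (_* ((v x - v y) * (v x - v y))) (indicator-yes (adj? G x y) xy) ⟨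
      a x y * ((v x - v y) * (v x - v y))  ≡⟨ total≡0⇒≡0 (energyDensity v v) (0≤energyDensity v) energy≡0 x y ⟩
      0ℚ                                   ∎))
      where
      open ≡-Reasoning
      p-q≡0⇒p≡q : ∀ p q → p - q ≡ 0ℚ → p ≡ q
      p-q≡0⇒p≡q p q eq = trans (solve 2 (λ p q → p := p :- q :+ q) refl p q)
        (trans (cong (_+ q) eq) (+-identityˡ q))

    along : ∀ {x y} → Star (Adj G) x y → v x ≡ v y
    along ε = refl
    along (xy ◅ path) = trans (step xy) (along path)

-- Effective resistance

-- The same expression as the vector in the definition of `resistance`, so that `resistance` unfolds
-- to the quadratic form of the pseudoinverse at a dipole.
dipole : ∀ {n} → Fin n → Fin n → Vector ℚ n
dipole x y z = basis x z - basis y z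

⊛-dipole : ∀ {m n} (A : Matrix m n) x y z → (A ⊛ dipole x y) z ≡ A z x - A z y
⊛-dipole A x y z = trans (·-comm (A z) (dipole x y)) ([basis-basis]·v x y (A z))

dipole·dipole : ∀ {n} {x y : Fin n} → x ≢ y → dipole x y · dipole x y ≡ 1ℚ + 1ℚ
dipole·dipole {x = x} {y} x≢y = trans ([basis-basis]·v x y (dipole x y)) (cong₂ _-_
  (cong₂ _-_ (basis-refl x) (basis-≢ (≢-sym x≢y)))
  (cong₂ _-_ (basis-≢ x≢y) (basis-refl y)))

module _ {n} (G : Graph (Fin n)) where

  private
    -- `P` is the orthogonal projection onto the column space of `L`, and `Q` is the complementary
    -- projection I - P. For a connected graph `Q` is J/n, obtained below from its being constant
    -- with column sums 1.
    a L M P Q : Matrix n n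
    a = adjacency G
    L = laplacian G
    M = L ⁺
    P = L ⊗ M
    Q z y = basis y z - P z y

    module MP = IsMoorePenrose (⁺-isMoorePenrose L)

  resistance-entries : ∀ x y → resistance G x y ≡ M x x - M x y - (M y x - M y y)
  resistance-entries x y = trans ([basis-basis]·v x y (M ⊛ dipole x y))
    (cong₂ _-_ (⊛-dipole M x y x) (⊛-dipole M x y y))

  resistance-self : ∀ x → resistance G x x ≡ 0ℚ
  resistance-self x = trans (resistance-entries x x) (+-inverseʳ (M x x - M x x))

  resistance-sym : ∀ x y → resistance G x y ≡ resistance G y x
  resistance-sym x y = trans (resistance-entries x y) (trans
    (solve 4 (λ p q r s → p :- q :- (r :- s) := s :- r :- (q :- p)) refl (M x x) (M x y) (M y x) (M y y))
    (sym (resistance-entries y x)))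

  -- Applying `laplacian-⊛` to the columns of `M` writes the trace of `P` as a sum over ordered
  -- edges; symmetrising that sum produces the resistances.
  total-a*resistance : total (λ x y → a x y * resistance G x y) ≡ sum (λ x → P x x) + sum (λ x → P x x)
  total-a*resistance = sym (begin
    sum (λ x → P x x) + sum (λ x → P x x)  ≡⟨ cong₂ _+_ trP trP ⟩
    total S + total S                      ≡⟨ total-symmetrise S ⟩
    total (λ x y → S x y + S y x)          ≡⟨ total-cong (λ x y → begin
      S x y + S y x                                    ≡⟨ cong (λ c → S x y + c * (M y y - M x y)) (adjacency-sym G y x) ⟩
      S x y + a x y * (M y y - M x y)                  ≡⟨ solve 5 (λ c p q r s → c :* (p :- r) :+ c :* (s :- q) := c :* (p :- q :- (r :- s)))
                                                            refl (a x y) (M x x) (M x y) (M y x) (M y y) ⟩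
      a x y * (M x x - M x y - (M y x - M y y))        ≡⟨ cong (a x y *_) (resistance-entries x y) ⟨
      a x y * resistance G x y                         ∎) ⟩
    total (λ x y → a x y * resistance G x y) ∎)
    where
    open ≡-Reasoning
    S : Matrix n n
    S x y = a x y * (M x x - M y x)
    trP : sum (λ x → P x x) ≡ total S
    trP = sum-cong-≗ λ x → laplacian-⊛ G ((M ᵀ) x) x

  module _ (connected : Connected G) where

    -- The transpose of the Penrose equation `P ⊗ L ≋ L`, since `L` and `P` are symmetric.
    LP≋L : L ⊗ P ≋ L
    LP≋L x y = begin
      L x · (P ᵀ) y        ≡⟨ ·-cong (laplacian-sym G x) (λ z → MP.AMᵀ≋AM y z) ⟩
      (L ᵀ) x · P y        ≡⟨ ·-comm ((L ᵀ) x) (P y) ⟩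
      (P ⊗ L) y x          ≡⟨ MP.AMA≋A y x ⟩
      L y x                ≡⟨ laplacian-sym G y x ⟩
      L x y                ∎
      where open ≡-Reasoning

    LQ≡0 : ∀ y x → (L ⊛ (λ z → Q z y)) x ≡ 0ℚ
    LQ≡0 y x = begin
      L x · (λ z → basis y z - P z y)      ≡⟨ ·-comm (L x) (λ z → Q z y) ⟩
      (λ z → basis y z - P z y) · L x      ≡⟨ ·-distribʳ-- (basis y) ((P ᵀ) y) (L x) ⟩
      basis y · L x - (P ᵀ) y · L x        ≡⟨ cong₂ _-_ (basis·v≡v y (L x)) (trans (·-comm ((P ᵀ) y) (L x)) (LP≋L x y)) ⟩
      L x y - L x y                        ≡⟨ +-inverseʳ (L x y) ⟩
      0ℚ                                   ∎
      where open ≡-Reasoning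

    Q-constantˡ : ∀ z z′ y → Q z y ≡ Q z′ y
    Q-constantˡ z z′ y = harmonic⇒constant G connected (λ z → Q z y) (LQ≡0 y) z z′

    Q-sym : ∀ z y → Q z y ≡ Q y z
    Q-sym z y = cong₂ _-_ (basis-sym y z) (MP.AMᵀ≋AM y z)

    -- The columns of `Q` are harmonic, hence constant, and symmetry carries this over to the rows.
    Q-constant : ∀ z y z′ y′ → Q z y ≡ Q z′ y′
    Q-constant z y z′ y′ = begin
      Q z y    ≡⟨ Q-constantˡ z y′ y ⟩
      Q y′ y   ≡⟨ Q-sym y′ y ⟩
      Q y y′   ≡⟨ Q-constantˡ y z′ y′ ⟩
      Q z′ y′  ∎
      where open ≡-Reasoning

    -- The all-ones vector lies in the kernel of the self-adjoint `L`, so it is orthogonal to every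
    -- column of `L ⊗ M`.
    column-sum-P : ∀ y → sum (λ z → P z y) ≡ 0ℚ
    column-sum-P y = begin
      sum (λ z → P z y)                         ≡⟨ sum-cong-≗ (λ z → *-identityˡ (P z y)) ⟨
      (λ _ → 1ℚ) · (L ⊛ (M ᵀ) y)                ≡⟨ laplacian-selfAdjoint G (λ _ → 1ℚ) ((M ᵀ) y) ⟩
      (M ᵀ) y · (L ⊛ (λ _ → 1ℚ))                ≡⟨ u·0≡0 ((M ᵀ) y) (L ⊛ (λ _ → 1ℚ)) L1≡0 ⟩
      0ℚ                                        ∎
      where
      open ≡-Reasoning
      L1≡0 : ∀ x → (L ⊛ (λ _ → 1ℚ)) x ≡ 0ℚ
      L1≡0 x = trans (laplacian-⊛ G (λ _ → 1ℚ) x) (u·0≡0 (a x) (λ _ → 1ℚ - 1ℚ) (λ _ → refl))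

    -- All entries of `Q` agree, so its trace equals the sum of any one column, which is 1. The
    -- vertex `o` selects that column.
    trace-P : Fin n → sum (λ x → P x x) ≡ sum {n} (λ _ → 1ℚ) - 1ℚ
    trace-P o = begin
      sum (λ x → P x x)
        ≡⟨ sum-cong-≗ (λ x → solve 2 (λ b p → p := b :- (b :- p)) refl (basis x x) (P x x)) ⟩
      sum (λ x → basis x x - Q x x)
        ≡⟨ sum-distrib-- (λ x → basis x x) (λ x → Q x x) ⟩
      sum {n} (λ x → basis x x) - sum (λ x → Q x x)
        ≡⟨ cong₂ _-_ (sum-cong-≗ {n} basis-refl) (sum-cong-≗ λ x → Q-constant x x x o) ⟩
      sum {n} (λ _ → 1ℚ) - sum (λ x → Q x o)
        ≡⟨ cong (λ q → sum {n} (λ _ → 1ℚ) - q) (trans (sum-distrib-- (basis o) ((P ᵀ) o))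
             (cong₂ _-_ (sum-basis o) (column-sum-P o))) ⟩
      sum {n} (λ _ → 1ℚ) - (1ℚ - 0ℚ)
        ≡⟨⟩
      sum {n} (λ _ → 1ℚ) - 1ℚ ∎
      where open ≡-Reasoning

    -- Foster's theorem, doubled because the sum runs over ordered pairs.
    foster : Fin n → total (λ x y → a x y * resistance G x y) ≡
             (sum {n} (λ _ → 1ℚ) - 1ℚ) + (sum {n} (λ _ → 1ℚ) - 1ℚ)
    foster o = trans total-a*resistance (cong₂ _+_ (trace-P o) (trace-P o))

    -- Applying `P` = I - Q to a dipole leaves the dipole, because the two columns of `Q` being
    -- subtracted are equal. Thus `M ⊛ dipole x y` is the potential of a unit current from `x` to
    -- `y`.
    potential : ∀ x y z → (L ⊛ (M ⊛ dipole x y)) z ≡ dipole x y z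
    potential x y z = begin
      (L ⊛ (M ⊛ dipole x y)) z             ≡⟨ ·-assoc (L z) M (dipole x y) ⟨
      (P ⊛ dipole x y) z                   ≡⟨ ⊛-dipole P x y z ⟩
      P z x - P z y                        ≡⟨ solve 4 (λ p q b c → p :- q := (b :- c) :+ ((c :- q) :- (b :- p)))
                                                refl (P z x) (P z y) (basis x z) (basis y z) ⟩
      dipole x y z + (Q z y - Q z x)       ≡⟨ cong (λ q → dipole x y z + (q - Q z x)) (Q-constant z y z x) ⟩
      dipole x y z + (Q z x - Q z x)       ≡⟨ cong (λ q → dipole x y z + q) (+-inverseʳ (Q z x)) ⟩
      dipole x y z + 0ℚ                    ≡⟨ +-identityʳ (dipole x y z) ⟩
      dipole x y z                         ∎
      where open ≡-Reasoning

    -- The energy of w - t d is nonnegative, where L w = d is the dipole.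
    resistance-lower-bound : ∀ {x y} → x ≢ y → ¬ Adj G x y → ∀ t →
      (t + t + (t + t)) - t * t * (degree G x + degree G y) ≤ resistance G x y
    resistance-lower-bound {x} {y} x≢y ¬xy t = 0≤q-p⇒p≤q (begin
      0ℚ
        ≤⟨ laplacian-nonNegative G u ⟩
      u · (L ⊛ u)
        ≡⟨ ·-linˡ w (- t) d (L ⊛ u) ⟩
      w · (L ⊛ u) + - t * (d · (L ⊛ u))
        ≡⟨ cong₂ (λ p q → p + - t * q) (expand w) (expand d) ⟩
      (d · w + - t * (w · (L ⊛ d))) + - t * (d · d + - t * (d · (L ⊛ d)))
        ≡⟨ cong₂ (λ p q → (d · w + - t * p) + - t * (q + - t * (d · (L ⊛ d)))) wLd dd ⟩
      (d · w + - t * 2ℚ) + - t * (2ℚ + - t * (d · (L ⊛ d)))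
        ≡⟨ cong (λ p → (d · w + - t * 2ℚ) + - t * (2ℚ + - t * p)) dLd ⟩
      (d · w + - t * 2ℚ) + - t * (2ℚ + - t * (degree G x + degree G y))
        ≡⟨ solve 3 (λ r t e → (r :+ (:- t) :* con 2ℚ) :+ (:- t) :* (con 2ℚ :+ (:- t) :* e) :=
             r :- ((t :+ t :+ (t :+ t)) :- t :* t :* e)) refl (d · w) t (degree G x + degree G y) ⟩
      resistance G x y - ((t + t + (t + t)) - t * t * (degree G x + degree G y)) ∎)
      where
      open ≤-Reasoning
      2ℚ = 1ℚ + 1ℚ
      d = dipole x y
      w = M ⊛ d
      u : Vector ℚ n
      u z = w z + - t * d z

      dd : d · d ≡ 2ℚ
      dd = dipole·dipole x≢y

      expand : ∀ v → v · (L ⊛ u) ≡ d · v + - t * (v · (L ⊛ d))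
      expand v = trans (laplacian-selfAdjoint G v u) (trans (·-linˡ w (- t) d (L ⊛ v))
        (cong₂ (λ p q → p + - t * q)
          (trans (laplacian-selfAdjoint G w v) (trans (·-cong {u = v} (λ _ → refl) (potential x y)) (·-comm v d)))
          (laplacian-selfAdjoint G d v)))

      wLd : w · (L ⊛ d) ≡ 2ℚ
      wLd = trans (laplacian-selfAdjoint G w d) (trans (·-cong {u = d} (λ _ → refl) (potential x y)) dd)

      diagonal : ∀ z → L z z ≡ degree G z
      diagonal z = trans (laplacian-entry G z z) (trans
        (cong₂ (λ b c → degree G z * b - c) (basis-refl z) (indicator-no (adj? G z z) (Graph.irreflexive G)))
        (solve 1 (λ e → e :* con 1ℚ :- con 0ℚ := e) refl (degree G z)))

      -- Nonadjacency removes the cross terms of the quadratic form at `d`, which leaves only the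
      -- two degrees.
      Lxy≡0 : L x y ≡ 0ℚ
      Lxy≡0 = trans (laplacian-entry G x y) (trans
        (cong₂ (λ b c → degree G x * b - c) (basis-≢ x≢y) (indicator-no (adj? G x y) ¬xy))
        (solve 1 (λ e → e :* con 0ℚ :- con 0ℚ := con 0ℚ) refl (degree G x)))

      dLd : d · (L ⊛ d) ≡ degree G x + degree G y
      dLd = trans ([basis-basis]·v x y (L ⊛ d)) (trans
        (cong₂ _-_ (trans (⊛-dipole L x y x) (cong₂ _-_ (diagonal x) Lxy≡0))
                   (trans (⊛-dipole L x y y) (cong₂ _-_ (trans (laplacian-sym G y x) Lxy≡0) (diagonal y))))
        (solve 2 (λ p q → (p :- con 0ℚ) :- (con 0ℚ :- q) := p :+ q) refl (degree G x) (degree G y)))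

    -- With L d = k d and L w = d, self-adjointness gives k (d · w) = w · L d = d · L w = d · d = 2.
    resistance-of-eigendipole : ∀ {x y} → x ≢ y → ∀ k →
      (∀ z → (L ⊛ dipole x y) z ≡ k * dipole x y z) → k * resistance G x y ≡ 1ℚ + 1ℚ
    resistance-of-eigendipole {x} {y} x≢y k Ld≡kd = begin
      k * (d · w)                    ≡⟨ *-distribˡ-sum k (λ z → d z * w z) ⟩
      sum (λ z → k * (d z * w z))    ≡⟨ sum-cong-≗ (λ z → trans (sym (*-assoc k (d z) (w z))) (*-comm (k * d z) (w z))) ⟩
      w · (λ z → k * d z)            ≡⟨ ·-cong {u = w} (λ _ → refl) Ld≡kd ⟨
      w · (L ⊛ d)                    ≡⟨ laplacian-selfAdjoint G w d ⟩
      d · (L ⊛ w)                    ≡⟨ ·-cong {u = d} (λ _ → refl) (potential x y) ⟩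
      d · d                          ≡⟨ dipole·dipole x≢y ⟩
      1ℚ + 1ℚ                        ∎
      where
      open ≡-Reasoning
      d = dipole x y
      w = M ⊛ d

-- Resistance is symmetric and zero on the diagonal, so doubling the sum over x < y removes the
-- order condition and makes Foster's theorem applicable.
kirchhoffIndex-double : ∀ {n} (G : Graph (Fin n)) →
  kirchhoffIndex G + kirchhoffIndex G ≡ total (resistance G)
kirchhoffIndex-double {n} G = trans (total-symmetrise T) (total-cong λ x y → by-cases x y (Fin.<-cmp x y))
  where
  T : Matrix n n
  T x y = if does (x Fin.<? y) then resistance G x y else 0ℚ

  T-< : ∀ {x y} → x Fin.< y → T x y ≡ resistance G x y
  T-< {x} {y} x<y = cong (if_then resistance G x y else 0ℚ) (dec-true (x Fin.<? y) x<y)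

  T-≮ : ∀ {x y} → ¬ x Fin.< y → T x y ≡ 0ℚ
  T-≮ {x} {y} x≮y = cong (if_then resistance G x y else 0ℚ) (dec-false (x Fin.<? y) x≮y)

  by-cases : ∀ x y → Tri (x Fin.< y) (x ≡ y) (y Fin.< x) → T x y + T y x ≡ resistance G x y
  by-cases x y (tri< x<y _ y≮x) = trans (cong₂ _+_ (T-< x<y) (T-≮ y≮x)) (+-identityʳ _)
  by-cases x y (tri> x≮y _ y<x) = trans (cong₂ _+_ (T-≮ x≮y) (T-< y<x))
    (trans (+-identityˡ _) (resistance-sym G y x))
  by-cases x .x (tri≈ x≮x refl _) = trans (cong₂ _+_ (T-≮ x≮x) (T-≮ x≮x))
    (trans (+-identityˡ 0ℚ) (sym (resistance-self G x)))

-- Deletion graphs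

-- The rational k, in a form that reduces along with sum.
count : ℕ → ℚ
count k = sum {k} (λ _ → 1ℚ)

indicator-× : ∀ {P R : Set} (P? : Dec P) (R? : Dec R) →
              indicator (P? ×-dec R?) ≡ indicator P? * indicator R?
indicator-× (yes _) (yes _) = refl
indicator-× (yes _) (no _)  = refl
indicator-× (no _)  R?      = sym (*-zeroˡ (indicator R?))

indicator-⊎ : ∀ {P R : Set} (P? : Dec P) (R? : Dec R) → ¬ (P × R) →
              indicator (P? ⊎-dec R?) ≡ indicator P? + indicator R?
indicator-⊎ (yes p) (yes r) ¬pr = contradiction (p , r) ¬pr
indicator-⊎ (yes _) (no _)  _   = refl
indicator-⊎ (no _)  R?      _   = sym (+-identityˡ (indicator R?))

-- The smaller endpoint is stored first, so two edges joining the same pair in opposite orientations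
-- would give both x < y and y < x.
joins-unique : ∀ {n} {x y : Fin n} {e e′ : Edge n} → e Joins x and y → e′ Joins x and y → e ≡ e′
joins-unique {e = edge _ _ _}   {edge _ _ _}   (inj₁ (refl , refl)) (inj₁ (refl , refl)) = refl
joins-unique {e = edge _ _ x<y} {edge _ _ y<x} (inj₁ (refl , refl)) (inj₂ (refl , refl)) =
  Data.Empty.Irrelevant.⊥-elim (Fin.<-asym x<y y<x)
joins-unique {e = edge _ _ y<x} {edge _ _ x<y} (inj₂ (refl , refl)) (inj₁ (refl , refl)) =
  Data.Empty.Irrelevant.⊥-elim (Fin.<-asym x<y y<x)
joins-unique {e = edge _ _ _}   {edge _ _ _}   (inj₂ (refl , refl)) (inj₂ (refl , refl)) = refl

fst≢snd : ∀ {n} (e : Edge n) → fst e ≢ snd e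
fst≢snd (edge x y x<y) refl = Data.Empty.Irrelevant.⊥-elim (Fin.<-irrefl refl x<y)

-- The adjacency matrix of the deletion graph, extended by zero to all vertices of `K n`; its row
-- sums are the degrees in the deletion graph.
linkMatrix : ∀ {n} → List (Edge n) → Matrix n n
linkMatrix F x y = indicator (linked? F x y)

linkDegree : ∀ {n} → List (Edge n) → Fin n → ℚ
linkDegree F x = sum (linkMatrix F x)

total-basis⊗basis : ∀ {n} (s t : Fin n) → total (λ x y → basis s x * basis t y) ≡ 1ℚ
total-basis⊗basis s t = trans
  (sum-cong-≗ λ x → trans (sym (*-distribˡ-sum (basis s x) (basis t)))
    (trans (cong (basis s x *_) (sum-basis t)) (*-identityʳ (basis s x))))
  (sum-basis s)

joins-indicator : ∀ {n} (e : Edge n) x y → indicator (joins? x y e) ≡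
  basis (fst e) x * basis (snd e) y + basis (fst e) y * basis (snd e) x
joins-indicator e x y = trans
  (indicator-⊎ (fst e Fin.≟ x ×-dec snd e Fin.≟ y) (fst e Fin.≟ y ×-dec snd e Fin.≟ x)
    λ ((fst≡x , _) , (_ , snd≡x)) → fst≢snd e (trans fst≡x (sym snd≡x)))
  (cong₂ _+_ (indicator-× (fst e Fin.≟ x) (snd e Fin.≟ y)) (indicator-× (fst e Fin.≟ y) (snd e Fin.≟ x)))

-- Handshake count: as the list has no repetition, each edge adds exactly two ordered pairs not
-- linked by the remaining edges.
total-linkMatrix : ∀ {n} {F : List (Edge n)} → Unique F →
  total (linkMatrix F) ≡ count (length F) + count (length F)
total-linkMatrix {n} [] = total-zero n
total-linkMatrix {n} {e ∷ F} (e∉F ∷ unique) = begin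
  total (linkMatrix (e ∷ F))
    ≡⟨ total-cong (λ x y → trans (indicator-⊎ (joins? x y e) (linked? F x y) (disjoint x y))
         (cong (_+ linkMatrix F x y) (joins-indicator e x y))) ⟩
  total (λ x y → (J x y + J y x) + linkMatrix F x y)
    ≡⟨ total-+ (λ x y → J x y + J y x) (linkMatrix F) ⟩
  total (λ x y → J x y + J y x) + total (linkMatrix F)
    ≡⟨ cong₂ _+_ (trans (sym (total-symmetrise J)) (cong₂ _+_ total-J total-J)) (total-linkMatrix unique) ⟩
  (1ℚ + 1ℚ) + (c + c)
    ≡⟨ solve 1 (λ c → (con 1ℚ :+ con 1ℚ) :+ (c :+ c) := (con 1ℚ :+ c) :+ (con 1ℚ :+ c)) refl c ⟩
  (1ℚ + c) + (1ℚ + c) ∎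
  where
  open ≡-Reasoning
  c = count (length F)
  J : Matrix n n
  J x y = basis (fst e) x * basis (snd e) y
  total-J : total J ≡ 1ℚ
  total-J = total-basis⊗basis (fst e) (snd e)
  disjoint : ∀ x y → ¬ (e Joins x and y × Linked F x y)
  disjoint x y (j , linked) = All.lookupWith (λ e≢e′ j′ → e≢e′ (joins-unique j j′)) e∉F linked

-- Maximum degree at most one in the deletion graph. This condition mediates between equality in the
-- bound and the isomorphism with copies of `K 2`.
IsMatching : ∀ {n} → List (Edge n) → Set
IsMatching F = ∀ x y z → Linked F x y → Linked F x z → y ≡ z

-- Adjacency and degrees after deleting `F` from the complete graph.

module _ {n} (F : List (Edge n)) where

  private
    G = K n ∖ F
    a l : Matrix n n
    a = adjacency G
    l = linkMatrix F
    N = count n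
    R : Matrix n n
    R = resistance G

  linked⇒≢ : ∀ {x y} → Linked F x y → x ≢ y
  linked⇒≢ xy refl = linked-irrefl F xy

  -- An ordered pair is exactly one of a surviving edge, a deleted edge or a diagonal pair.
  a+l+basis≡1 : ∀ x y → a x y + l x y + basis x y ≡ 1ℚ
  a+l+basis≡1 x y = by-cases (x Fin.≟ y) (linked? F x y)
    where
    by-cases : Dec (x ≡ y) → Dec (Linked F x y) → a x y + l x y + basis x y ≡ 1ℚ
    by-cases (yes refl) _ = cong₂ _+_ (cong₂ _+_
      (indicator-no (adj? G x x) (Graph.irreflexive G)) (indicator-no (linked? F x x) (linked-irrefl F))) (basis-refl x)
    by-cases (no x≢y) (yes xy) = cong₂ _+_ (cong₂ _+_
      (indicator-no (adj? G x y) (λ (_ , ¬xy) → ¬xy xy)) (indicator-yes (linked? F x y) xy)) (basis-≢ x≢y)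
    by-cases (no x≢y) (no ¬xy) = cong₂ _+_ (cong₂ _+_
      (indicator-yes (adj? G x y) (x≢y , ¬xy)) (indicator-no (linked? F x y) ¬xy)) (basis-≢ x≢y)

  a≡1-l-basis : ∀ x y → a x y ≡ 1ℚ - l x y - basis x y
  a≡1-l-basis x y = trans
    (solve 3 (λ a l b → a := a :+ l :+ b :- l :- b) refl (a x y) (l x y) (basis x y))
    (cong (λ s → s - l x y - basis x y) (a+l+basis≡1 x y))

  degree≡N-linkDegree-1 : ∀ x → degree G x ≡ N - linkDegree F x - 1ℚ
  degree≡N-linkDegree-1 x = begin
    sum (a x)                                        ≡⟨ sum-cong-≗ (a≡1-l-basis x) ⟩
    sum (λ y → 1ℚ - l x y - basis x y)               ≡⟨ sum-distrib-- (λ y → 1ℚ - l x y) (basis x) ⟩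
    sum (λ y → 1ℚ - l x y) - sum (basis x)           ≡⟨ cong₂ _-_ (sum-distrib-- (λ _ → 1ℚ) (l x)) (sum-basis x) ⟩
    N - linkDegree F x - 1ℚ                          ∎
    where open ≡-Reasoning

  basis≤l : ∀ {x y} → Linked F x y → ∀ z → basis y z ≤ l x z
  basis≤l {x} {y} xy z = by-cases (y Fin.≟ z)
    where
    by-cases : Dec (y ≡ z) → basis y z ≤ l x z
    by-cases (yes refl) = ≤-reflexive (trans (basis-refl y) (sym (indicator-yes (linked? F x y) xy)))
    by-cases (no y≢z) = subst (_≤ l x z) (sym (basis-≢ y≢z)) (0≤indicator (linked? F x z))

  1≤linkDegree : ∀ {x y} → Linked F x y → 1ℚ ≤ linkDegree F x
  1≤linkDegree {x} {y} xy = subst (_≤ linkDegree F x) (sum-basis y) (sum-mono (basis≤l xy))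

  2≤linkDegree : ∀ {x y z} → Linked F x y → Linked F x z → y ≢ z → 1ℚ + 1ℚ ≤ linkDegree F x
  2≤linkDegree {x} {y} {z} xy xz y≢z = subst (_≤ linkDegree F x)
    (trans (∑-distrib-+ (basis y) (basis z)) (cong₂ _+_ (sum-basis y) (sum-basis z)))
    (sum-mono λ w → by-cases w (y Fin.≟ w))
    where
    by-cases : ∀ w → Dec (y ≡ w) → basis y w + basis z w ≤ l x w
    by-cases w (yes refl) = subst (_≤ l x w)
      (sym (trans (cong (basis y y +_) (basis-≢ (≢-sym y≢z))) (+-identityʳ (basis y y)))) (basis≤l xy w)
    by-cases w (no y≢w) = subst (_≤ l x w)
      (sym (trans (cong (_+ basis z w) (basis-≢ y≢w)) (+-identityˡ (basis z w)))) (basis≤l xz w)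

  -- Excess of the resistance across deleted edges over 2/(n - 2).

  module _ (connected : Connected G) (o : Fin n)
           -- The number 1/(n - 2), specified by an equation so that the ring solver meets no
           -- division.
           (t : ℚ) {{t>0 : Positive t}} (t[N-2]≡1 : t * (N - (1ℚ + 1ℚ)) ≡ 1ℚ) where

    private
      2ℚ = 1ℚ + 1ℚ

    -- Degrees in `G` are n - 1 minus those in the deletion graph. Writing 2t as 2t times t(n - 2)
    -- makes the rearrangement of `resistance-lower-bound` a polynomial identity.
    resistance-excess : ∀ {x y} → Linked F x y →
      t * t * ((linkDegree F x - 1ℚ) + (linkDegree F y - 1ℚ)) ≤ R x y - (t + t)
    resistance-excess {x} {y} xy = begin
      t * t * ((dx - 1ℚ) + (dy - 1ℚ))
        ≡⟨ solve 4 (λ t N p q → t :* t :* ((p :- con 1ℚ) :+ (q :- con 1ℚ)) :=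
             (t :+ t) :* (t :* (N :- con 2ℚ)) :- t :* t :* ((N :- p :- con 1ℚ) :+ (N :- q :- con 1ℚ)))
             refl t N dx dy ⟩
      (t + t) * (t * (N - 2ℚ)) - t * t * ((N - dx - 1ℚ) + (N - dy - 1ℚ))
        ≡⟨ cong₂ (λ p q → (t + t) * p - t * t * q) t[N-2]≡1
             (cong₂ _+_ (sym (degree≡N-linkDegree-1 x)) (sym (degree≡N-linkDegree-1 y))) ⟩
      (t + t) * 1ℚ - t * t * (degree G x + degree G y)
        ≡⟨ solve 2 (λ t e → (t :+ t) :* con 1ℚ :- e := ((t :+ t :+ (t :+ t)) :- e) :- (t :+ t))
             refl t (t * t * (degree G x + degree G y)) ⟩
      ((t + t + (t + t)) - t * t * (degree G x + degree G y)) - (t + t)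
        ≤⟨ +-monoˡ-≤ (- (t + t)) (resistance-lower-bound G connected (linked⇒≢ xy) (λ (_ , ¬xy) → ¬xy xy) t) ⟩
      R x y - (t + t) ∎
      where
      open ≤-Reasoning
      dx = linkDegree F x
      dy = linkDegree F y

    instance
      t*t>0 : Positive (t * t)
      t*t>0 = pos*pos⇒pos t t

    0≤resistance-excess : ∀ {x y} → Linked F x y → 0ℚ ≤ R x y - (t + t)
    0≤resistance-excess xy = ≤-trans
      (0≤p*q (nonNegative⁻¹ (t * t) {{pos⇒nonNeg (t * t)}})
        (+-mono-≤ (p≤q⇒0≤q-p (1≤linkDegree xy)) (p≤q⇒0≤q-p (1≤linkDegree (linked-sym F xy)))))
      (resistance-excess xy)

    -- Supported on the deleted edges; its total is twice the gap between the Kirchhoff index and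
    -- the bound.
    excess : Matrix n n
    excess x y = l x y * (R x y - (t + t))

    0≤excess : ∀ x y → 0ℚ ≤ excess x y
    0≤excess x y = by-cases (linked? F x y)
      where
      by-cases : Dec (Linked F x y) → 0ℚ ≤ excess x y
      by-cases (yes xy) = 0≤p*q (0≤indicator (linked? F x y)) (0≤resistance-excess xy)
      by-cases (no ¬xy) = ≤-reflexive (sym (trans
        (cong (_* (R x y - (t + t))) (indicator-no (linked? F x y) ¬xy)) (*-zeroˡ (R x y - (t + t)))))

    -- Two distinct partners of `x` raise its degree in the deletion graph to at least 2, so the
    -- excess at `x`, `y` is at least t * t > 0; yet a vanishing sum of nonnegative entries has
    -- every entry zero.
    excess≡0⇒isMatching : total excess ≡ 0ℚ → IsMatching F
    excess≡0⇒isMatching total≡0 x y z xy xz with y Fin.≟ z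
    ... | yes y≡z = y≡z
    ... | no y≢z = contradiction 1≤0 (from-no (1ℚ ≤? 0ℚ))
      where
      open ≤-Reasoning
      dx = linkDegree F x
      dy = linkDegree F y
      1≤0 : 1ℚ ≤ 0ℚ
      1≤0 = *-cancelˡ-≤-pos (t * t) (begin
        t * t * 1ℚ
          ≤⟨ *-monoˡ-≤-nonNeg (t * t) {{pos⇒nonNeg (t * t)}}
               (+-mono-≤ (+-monoˡ-≤ (- 1ℚ) (2≤linkDegree xy xz y≢z)) (p≤q⇒0≤q-p (1≤linkDegree (linked-sym F xy)))) ⟩
        t * t * ((dx - 1ℚ) + (dy - 1ℚ))  ≤⟨ resistance-excess xy ⟩
        R x y - (t + t)                  ≡⟨ *-identityˡ (R x y - (t + t)) ⟨
        1ℚ * (R x y - (t + t))           ≡⟨ cong (_* (R x y - (t + t))) (indicator-yes (linked? F x y) xy) ⟨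
        excess x y                       ≡⟨ total≡0⇒≡0 excess 0≤excess total≡0 x y ⟩
        0ℚ                               ≡⟨ *-zeroʳ (t * t) ⟨
        t * t * 0ℚ                       ∎)

    matching-resistance : IsMatching F → ∀ {x y} → Linked F x y → R x y ≡ t + t
    matching-resistance matching {x} {y} xy = begin
      R x y                      ≡⟨ *-identityˡ (R x y) ⟨
      1ℚ * R x y                 ≡⟨ cong (_* R x y) t[N-2]≡1 ⟨
      t * (N - 2ℚ) * R x y       ≡⟨ *-assoc t (N - 2ℚ) (R x y) ⟩
      t * ((N - 2ℚ) * R x y)     ≡⟨ cong (t *_) (resistance-of-eigendipole G connected (linked⇒≢ xy) (N - 2ℚ) eigen) ⟩
      t * 2ℚ                     ≡⟨ solve 1 (λ t → t :* con 2ℚ := t :+ t) refl t ⟩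
      t + t                      ∎
      where
      open ≡-Reasoning

      -- In a matching `x` has degree n - 2 in `G` and misses only `y`. In the difference of this
      -- formula and the one with `x` and `y` exchanged, the constants cancel and the factor n - 2
      -- appears.
      row : ∀ {x y} → Linked F x y → ∀ z → laplacian G z x ≡ (N - 1ℚ) * basis x z + basis y z - 1ℚ
      row {x} {y} xy z = begin
        laplacian G z x
          ≡⟨ trans (laplacian-sym G z x) (laplacian-entry G x z) ⟩
        degree G x * basis x z - a x z
          ≡⟨ cong₂ (λ p q → p * basis x z - q) (degree≡N-linkDegree-1 x) (a≡1-l-basis x z) ⟩
        (N - linkDegree F x - 1ℚ) * basis x z - (1ℚ - l x z - basis x z)
          ≡⟨ cong₂ (λ p q → (N - p - 1ℚ) * basis x z - (1ℚ - q - basis x z))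
               (trans (sum-cong-≗ l≡basis) (sum-basis y)) (l≡basis z) ⟩
        (N - 1ℚ - 1ℚ) * basis x z - (1ℚ - basis y z - basis x z)
          ≡⟨ solve 3 (λ N b c → (N :- con 1ℚ :- con 1ℚ) :* b :- (con 1ℚ :- c :- b) :=
               (N :- con 1ℚ) :* b :+ c :- con 1ℚ) refl N (basis x z) (basis y z) ⟩
        (N - 1ℚ) * basis x z + basis y z - 1ℚ ∎
        where
        l≡basis : ∀ z → l x z ≡ basis y z
        l≡basis z = indicator-⇔ (linked? F x z) (y Fin.≟ z) (mk⇔ (matching x y z xy) λ { refl → xy })

      eigen : ∀ z → (laplacian G ⊛ dipole x y) z ≡ (N - 2ℚ) * dipole x y z
      eigen z = trans (⊛-dipole (laplacian G) x y z) (trans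
        (cong₂ _-_ (row xy z) (row (linked-sym F xy) z))
        (solve 3 (λ N b c → ((N :- con 1ℚ) :* b :+ c :- con 1ℚ) :- ((N :- con 1ℚ) :* c :+ b :- con 1ℚ) :=
           (N :- con 2ℚ) :* (b :- c)) refl N (basis x z) (basis y z)))

    isMatching⇒excess≡0 : IsMatching F → total excess ≡ 0ℚ
    isMatching⇒excess≡0 matching = trans (total-cong λ x y → by-cases x y (linked? F x y))
      (total-zero n)
      where
      by-cases : ∀ x y → Dec (Linked F x y) → excess x y ≡ 0ℚ
      by-cases x y (yes xy) = trans
        (cong (λ r → l x y * (r - (t + t))) (matching-resistance matching xy))
        (solve 2 (λ l t → l :* (t :- t) := con 0ℚ) refl (l x y) (t + t))
      by-cases x y (no ¬xy) = trans
        (cong (_* (R x y - (t + t))) (indicator-no (linked? F x y) ¬xy)) (*-zeroˡ (R x y - (t + t)))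

    -- The bound on the Kirchhoff index and its equality case.

    module _ (unique : Unique F) where

      private
        c = count (length F)
        B = (N - 1ℚ) + (c + c) * t

      -- Split the sum of all resistances by `a+l+basis≡1`: surviving edges contribute 2(n - 1) by
      -- Foster's theorem, deleted edges contribute 2t per ordered pair plus the excess, and the
      -- diagonal contributes nothing.
      kirchhoffIndex-excess : kirchhoffIndex G + kirchhoffIndex G ≡ (B + B) + total excess
      kirchhoffIndex-excess = begin
        kirchhoffIndex G + kirchhoffIndex G
          ≡⟨ kirchhoffIndex-double G ⟩
        total R
          ≡⟨ total-cong split ⟩
        total (λ x y → a x y * R x y + ((t + t) * l x y + excess x y))
          ≡⟨ trans (total-+ (λ x y → a x y * R x y) _)
               (cong (total (λ x y → a x y * R x y) +_) (total-+ (λ x y → (t + t) * l x y) excess)) ⟩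
        total (λ x y → a x y * R x y) + (total (λ x y → (t + t) * l x y) + total excess)
          ≡⟨ cong₂ (λ p q → p + (q + total excess)) (foster G connected o)
               (trans (sym (*-distribˡ-total (t + t) l)) (cong ((t + t) *_) (total-linkMatrix unique))) ⟩
        ((N - 1ℚ) + (N - 1ℚ)) + ((t + t) * (c + c) + total excess)
          ≡⟨ solve 4 (λ m t c e → (m :+ m) :+ ((t :+ t) :* c :+ e) := ((m :+ c :* t) :+ (m :+ c :* t)) :+ e)
               refl (N - 1ℚ) t (c + c) (total excess) ⟩
        (B + B) + total excess ∎
        where
        open ≡-Reasoning
        basis*R≡0 : ∀ x y → basis x y * R x y ≡ 0ℚ
        basis*R≡0 x y with x Fin.≟ y
        ... | yes refl = trans (*-identityˡ (R x x)) (resistance-self G x)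
        ... | no _ = *-zeroˡ (R x y)
        split : ∀ x y → R x y ≡ a x y * R x y + ((t + t) * l x y + excess x y)
        split x y = begin
          R x y
            ≡⟨ *-identityˡ (R x y) ⟨
          1ℚ * R x y
            ≡⟨ cong (_* R x y) (a+l+basis≡1 x y) ⟨
          (a x y + l x y + basis x y) * R x y
            ≡⟨ solve 5 (λ a l b r t → (a :+ l :+ b) :* r := (a :* r :+ (t :* l :+ l :* (r :- t))) :+ b :* r)
                 refl (a x y) (l x y) (basis x y) (R x y) (t + t) ⟩
          (a x y * R x y + ((t + t) * l x y + excess x y)) + basis x y * R x y
            ≡⟨ trans (cong (a x y * R x y + ((t + t) * l x y + excess x y) +_) (basis*R≡0 x y))
                 (+-identityʳ (a x y * R x y + ((t + t) * l x y + excess x y))) ⟩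
          a x y * R x y + ((t + t) * l x y + excess x y) ∎

      kirchhoffIndex-bound : B ≤ kirchhoffIndex G
      kirchhoffIndex-bound = *-cancelˡ-≤-pos 2ℚ (begin
        2ℚ * B                                ≡⟨ solve 1 (λ b → con 2ℚ :* b := b :+ b :+ con 0ℚ) refl B ⟩
        (B + B) + 0ℚ                          ≤⟨ +-monoʳ-≤ (B + B) (0≤total excess 0≤excess) ⟩
        (B + B) + total excess                ≡⟨ kirchhoffIndex-excess ⟨
        kirchhoffIndex G + kirchhoffIndex G   ≡⟨ solve 1 (λ k → k :+ k := con 2ℚ :* k) refl (kirchhoffIndex G) ⟩
        2ℚ * kirchhoffIndex G                 ∎)
        where open ≤-Reasoning

      kirchhoffIndex≡bound⇔isMatching : kirchhoffIndex G ≡ B ⇔ IsMatching F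
      kirchhoffIndex≡bound⇔isMatching = mk⇔
        (λ eq → excess≡0⇒isMatching (begin
          total excess
            ≡⟨ solve 2 (λ b e → e := b :+ e :- b) refl (B + B) (total excess) ⟩
          (B + B) + total excess - (B + B)
            ≡⟨ cong (_- (B + B)) (trans (sym kirchhoffIndex-excess) (cong₂ _+_ eq eq)) ⟩
          (B + B) - (B + B)
            ≡⟨ +-inverseʳ (B + B) ⟩
          0ℚ ∎))
        (λ matching → *-cancelˡ-≡ (begin
          2ℚ * kirchhoffIndex G                ≡⟨ solve 1 (λ k → con 2ℚ :* k := k :+ k) refl (kirchhoffIndex G) ⟩
          kirchhoffIndex G + kirchhoffIndex G  ≡⟨ kirchhoffIndex-excess ⟩
          (B + B) + total excess               ≡⟨ cong (B + B +_) (isMatching⇒excess≡0 matching) ⟩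
          (B + B) + 0ℚ                         ≡⟨ solve 1 (λ b → b :+ b :+ con 0ℚ := con 2ℚ :* b) refl B ⟩
          2ℚ * B                               ∎))
        where
        open ≡-Reasoning
        *-cancelˡ-≡ : ∀ {p q} → 2ℚ * p ≡ 2ℚ * q → p ≡ q
        *-cancelˡ-≡ eq = ≤-antisym (*-cancelˡ-≤-pos 2ℚ (≤-reflexive eq)) (*-cancelˡ-≤-pos 2ℚ (≤-reflexive (sym eq)))

-- Matchings and disjoint copies of K₂

side : ∀ {n} → Edge n → Fin 2 → Fin n
side e zero       = fst e
side e (suc zero) = snd e

opposite : Fin 2 → Fin 2
opposite zero       = suc zero
opposite (suc zero) = zero

-- Turns adjacency in `K 2`, which is `_≢_`, into an equation for the neighbour.
≢⇒≡opposite : ∀ {u v : Fin 2} → u ≢ v → v ≡ opposite u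
≢⇒≡opposite {zero}     {zero}     u≢v = contradiction refl u≢v
≢⇒≡opposite {zero}     {suc zero} _   = refl
≢⇒≡opposite {suc zero} {zero}     _   = refl
≢⇒≡opposite {suc zero} {suc zero} u≢v = contradiction refl u≢v

side-joins : ∀ {n} (e : Edge n) u → e Joins side e u and side e (opposite u)
side-joins e zero       = inj₁ (refl , refl)
side-joins e (suc zero) = inj₂ (refl , refl)

side-injective : ∀ {n} (e : Edge n) {u v} → side e u ≡ side e v → u ≡ v
side-injective e {zero}     {zero}     _  = refl
side-injective e {zero}     {suc zero} eq = contradiction eq (fst≢snd e)
side-injective e {suc zero} {zero}     eq = contradiction (sym eq) (fst≢snd e)
side-injective e {suc zero} {suc zero} _  = refl

Unique⇒lookup-injective : ∀ {A : Set} {xs : List A} → Unique xs →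
  ∀ i j → lookup xs i ≡ lookup xs j → i ≡ j
Unique⇒lookup-injective (_ ∷ _) zero zero _ = refl
Unique⇒lookup-injective {xs = x ∷ xs} (x∉ ∷ _) zero (suc j) eq = contradiction eq (All.lookup x∉ (∈-lookup j))
Unique⇒lookup-injective {xs = x ∷ xs} (x∉ ∷ _) (suc i) zero eq = contradiction (sym eq) (All.lookup x∉ (∈-lookup i))
Unique⇒lookup-injective (_ ∷ unique) (suc i) (suc j) eq = cong suc (Unique⇒lookup-injective unique i j eq)

linked⇒endpoint : ∀ {n} {F : List (Edge n)} {x y} → Linked F x y → Any (x EndpointOf_) F
linked⇒endpoint = Any.map λ { (inj₁ (fst≡x , _)) → inj₁ fst≡x ; (inj₂ (_ , snd≡x)) → inj₂ snd≡x }

-- In copies of `K 2` the only neighbour of `(i , u)` is `(i , opposite u)`, so two partners of `x`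
-- have the same image and coincide.
≅copies⇒isMatching : ∀ {n} (F : List (Edge n)) {k} → H F ≅ k copies K 2 → IsMatching F
≅copies⇒isMatching F {k} (f , f-adj) x y z xy xz = cong value (begin
  ŷ              ≡⟨ strictlyInverseʳ ŷ ⟨
  from (to ŷ)    ≡⟨ cong from (trans (image ŷ xy) (sym (image ẑ xz))) ⟩
  from (to ẑ)    ≡⟨ strictlyInverseʳ ẑ ⟩
  ẑ              ∎)
  where
  open ≡-Reasoning
  open Inverse f
  x̂ ŷ ẑ : V⟨ F ⟩
  x̂ = x , [ linked⇒endpoint xy ]
  ŷ = y , [ linked⇒endpoint (linked-sym F xy) ]
  ẑ = z , [ linked⇒endpoint (linked-sym F xz) ]

  image : ∀ w → Linked F x (value w) → to w ≡ (proj₁ (to x̂) , opposite (proj₂ (to x̂)))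
  image w xw with Equivalence.to (f-adj x̂ w) xw
  ... | i≡j , u≢v = cong₂ _,_ (sym i≡j) (≢⇒≡opposite u≢v)

module _ {n} (F : List (Edge n)) (unique : Unique F) (matching : IsMatching F) where

  private
    -- An edge of `F` with a chosen endpoint; equally, a vertex of `length F copies K 2`.
    Dart : Set
    Dart = Fin (length F) × Fin 2

  tip : Dart → Fin n
  tip (i , u) = side (lookup F i) u

  tip-linked : ∀ i u → Linked F (tip (i , u)) (tip (i , opposite u))
  tip-linked i u = lose (∈-lookup i) (side-joins (lookup F i) u)

  tip-injective : ∀ {d d′} → tip d ≡ tip d′ → d ≡ d′
  tip-injective {i , u} {j , v} eq with i≡j
    where
    -- In a matching a shared tip forces a shared partner. Both edges then join the same pair, so
    -- they are equal, and uniqueness of the list identifies their positions.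
    partner : tip (i , opposite u) ≡ tip (j , opposite v)
    partner = matching (tip (i , u)) _ _ (tip-linked i u)
      (subst (λ x → Linked F x (tip (j , opposite v))) (sym eq) (tip-linked j v))
    i≡j : i ≡ j
    i≡j = Unique⇒lookup-injective unique i j (joins-unique (side-joins (lookup F i) u)
      (subst₂ (lookup F j Joins_and_) (sym eq) (sym partner) (side-joins (lookup F j) v)))
  ... | refl = cong (i ,_) (side-injective (lookup F i) eq)

  dart : ∀ {x} → Any (x EndpointOf_) F → ∃ λ d → tip d ≡ x
  dart p with lookup-index p
  ... | inj₁ fst≡x = (Any.index p , zero) , fst≡x
  ... | inj₂ snd≡x = (Any.index p , suc zero) , snd≡x

  endpointOf? : ∀ x (e : Edge n) → Dec (x EndpointOf e)
  endpointOf? x e = fst e Fin.≟ x ⊎-dec snd e Fin.≟ x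

  dartAt : (x : V⟨ F ⟩) → ∃ λ d → tip d ≡ value x
  -- The membership proof is irrelevant; deciding membership again yields a usable witness.
  dartAt (x , [ p ]) = dart (recompute (any? (endpointOf? x) F) p)

  vertexOf : Dart → V⟨ F ⟩
  vertexOf (i , u) = tip (i , u) , [ linked⇒endpoint (tip-linked i u) ]

  V↔Dart : V⟨ F ⟩ ↔ Dart
  V↔Dart = mk↔ₛ′ (proj₁ ∘ dartAt) vertexOf
    (λ d → tip-injective (proj₂ (dartAt (vertexOf d))))
    (λ x → value-injective (proj₂ (dartAt x)))

  isMatching⇒≅copies : H F ≅ length F copies K 2
  isMatching⇒≅copies = V↔Dart , λ x y → mk⇔ (preserves x y) (reflects x y)
    where
    -- Whichever edge the search in `dartAt` finds, injectivity of `tip` identifies it with any dart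
    -- known to end at `x`.
    at : ∀ x {d} → tip d ≡ value x → proj₁ (dartAt x) ≡ d
    at x tip≡x = tip-injective (trans (proj₂ (dartAt x)) (sym tip≡x))

    preserves : ∀ x y → Adj (H F) x y → Adj (length F copies K 2) (proj₁ (dartAt x)) (proj₁ (dartAt y))
    preserves x y xy with lookup-index xy
    ... | inj₁ (fst≡x , snd≡y) = subst₂ (Adj (length F copies K 2))
      (sym (at x {_ , zero} fst≡x)) (sym (at y {_ , suc zero} snd≡y)) (refl , λ ())
    ... | inj₂ (fst≡y , snd≡x) = subst₂ (Adj (length F copies K 2))
      (sym (at x {_ , suc zero} snd≡x)) (sym (at y {_ , zero} fst≡y)) (refl , λ ())

    reflects : ∀ x y → Adj (length F copies K 2) (proj₁ (dartAt x)) (proj₁ (dartAt y)) → Adj (H F) x y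
    reflects x y (i≡j , u≢v) = subst₂ (Linked F)
      (proj₂ (dartAt x))
      (trans (cong tip (cong₂ _,_ i≡j (sym (≢⇒≡opposite u≢v)))) (proj₂ (dartAt y)))
      (tip-linked (proj₁ (proj₁ (dartAt x))) (proj₂ (proj₁ (dartAt x))))

-- The rational bound

open import Data.Integer.Base as ℤ using (+_)

-- `fromℚᵘ (mkℚᵘ i m)` unfolds to `i / suc m`, so sums of fractions can be computed in the
-- unnormalised rationals.
fromℚᵘ-homo-+ : ∀ p q → fromℚᵘ (p ℚᵘ.+ q) ≡ fromℚᵘ p + fromℚᵘ q
fromℚᵘ-homo-+ p q = toℚᵘ-injective (begin-equality
  toℚᵘ (fromℚᵘ (p ℚᵘ.+ q))                 ≃⟨ toℚᵘ-fromℚᵘ (p ℚᵘ.+ q) ⟩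
  p ℚᵘ.+ q                                 ≃⟨ ℚᵘ.+-cong (toℚᵘ-fromℚᵘ p) (toℚᵘ-fromℚᵘ q) ⟨
  toℚᵘ (fromℚᵘ p) ℚᵘ.+ toℚᵘ (fromℚᵘ q)     ≃⟨ toℚᵘ-homo-+ (fromℚᵘ p) (fromℚᵘ q) ⟨
  toℚᵘ (fromℚᵘ p + fromℚᵘ q)               ∎)
  where open ℚᵘ.≤-Reasoning

fromℚᵘ-homo-* : ∀ p q → fromℚᵘ (p ℚᵘ.* q) ≡ fromℚᵘ p * fromℚᵘ q
fromℚᵘ-homo-* p q = toℚᵘ-injective (begin-equality
  toℚᵘ (fromℚᵘ (p ℚᵘ.* q))                 ≃⟨ toℚᵘ-fromℚᵘ (p ℚᵘ.* q) ⟩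
  p ℚᵘ.* q                                 ≃⟨ ℚᵘ.*-cong (toℚᵘ-fromℚᵘ p) (toℚᵘ-fromℚᵘ q) ⟨
  toℚᵘ (fromℚᵘ p) ℚᵘ.* toℚᵘ (fromℚᵘ q)     ≃⟨ toℚᵘ-homo-* (fromℚᵘ p) (fromℚᵘ q) ⟨
  toℚᵘ (fromℚᵘ p * fromℚᵘ q)               ∎)
  where open ℚᵘ.≤-Reasoning

/1-count : ∀ k → + k / 1 ≡ count k
/1-count zero    = refl
/1-count (suc k) = begin
  + suc k / 1                              ≡⟨ cong (λ i → i / 1) (cong₂ ℤ._+_ (ℤ.*-identityʳ (+ 1)) (ℤ.*-identityʳ (+ k))) ⟨
  fromℚᵘ (mkℚᵘ (+ 1) 0 ℚᵘ.+ mkℚᵘ (+ k) 0)  ≡⟨ fromℚᵘ-homo-+ (mkℚᵘ (+ 1) 0) (mkℚᵘ (+ k) 0) ⟩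
  1ℚ + + k / 1                             ≡⟨ cong (λ q → 1ℚ + q) (/1-count k) ⟩
  1ℚ + count k                             ∎
  where open ≡-Reasoning

/-count : ∀ k m → + k / suc m ≡ count k * (+ 1 / suc m)
/-count k m = begin
  fromℚᵘ (mkℚᵘ (+ k) m)                          ≡⟨ fromℚᵘ-cong {mkℚᵘ (+ k) 0 ℚᵘ.* mkℚᵘ (+ 1) m} {mkℚᵘ (+ k) m} (*≡* (cong₂ ℤ._*_ (ℤ.*-identityʳ (+ k)) (cong (λ d → + suc d) (sym (ℕ.+-identityʳ m))))) ⟨
  fromℚᵘ (mkℚᵘ (+ k) 0 ℚᵘ.* mkℚᵘ (+ 1) m)        ≡⟨ fromℚᵘ-homo-* (mkℚᵘ (+ k) 0) (mkℚᵘ (+ 1) m) ⟩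
  (+ k / 1) * (+ 1 / suc m)                      ≡⟨ cong (_* (+ 1 / suc m)) (/1-count k) ⟩
  count k * (+ 1 / suc m)                        ∎
  where open ≡-Reasoning

count-+ : ∀ j k → count (j ℕ.+ k) ≡ count j + count k
count-+ zero    k = sym (+-identityˡ (count k))
count-+ (suc j) k = trans (cong (λ q → 1ℚ + q) (count-+ j k)) (sym (+-assoc 1ℚ (count j) (count k)))

corollary5p1 :
    (n : ℕ) (n≥3 : 3 ℕ.≤ n) (F : List (Edge n)) → Unique F →
    (p : ℕ) → length F ≡ p → 1 ℕ.≤ p →
    Connected (K n ∖ F) →
    let instance n-2≢0 = >-nonZero (m<n⇒0<n∸m n≥3)
        bound : ℚ
        bound = + (n ∸ 1) / 1 + + (2 ℕ.* p) / (n ∸ 2)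
    in bound ≤ kirchhoffIndex (K n ∖ F)
       × (kirchhoffIndex (K n ∖ F) ≡ bound ⇔ H F ≅ p copies K 2)
-- With n = m + 3, `n ∸ 2` computes to `suc m` and `count n` exposes two leading summands 1. The
-- vertex `zero` serves as the reference vertex in Foster's theorem.
corollary5p1 n@(suc (suc (suc m))) (ℕ.s≤s (ℕ.s≤s (ℕ.s≤s ℕ.z≤n))) F unique p refl 1≤p connected =
  subst (_≤ kirchhoffIndex G) (sym bound≡B) (kirchhoffIndex-bound F connected zero t t[N-2]≡1 unique) ,
  mk⇔ (λ eq → isMatching⇒≅copies F unique (Equivalence.to extremal (trans eq bound≡B)))
      (λ iso → trans (Equivalence.from extremal (≅copies⇒isMatching F iso)) (sym bound≡B))
  where
  open ≡-Reasoning
  G = K n ∖ F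

  t : ℚ
  t = + 1 / suc m

  instance
    t>0 : Positive t
    t>0 = normalize-pos 1 (suc m)

  t[N-2]≡1 : t * (count n - (1ℚ + 1ℚ)) ≡ 1ℚ
  t[N-2]≡1 = begin
    t * (count n - (1ℚ + 1ℚ))
      ≡⟨ solve 2 (λ t c → t :* ((con 1ℚ :+ (con 1ℚ :+ c)) :- (con 1ℚ :+ con 1ℚ)) := c :* t) refl t (count (suc m)) ⟩
    count (suc m) * t
      ≡⟨ /-count (suc m) m ⟨
    + suc m / suc m
      ≡⟨ fromℚᵘ-cong {mkℚᵘ (+ suc m) m} {mkℚᵘ (+ 1) 0} (*≡* (ℤ.*-comm (+ suc m) (+ 1))) ⟩
    1ℚ ∎

  extremal : kirchhoffIndex G ≡ (count n - 1ℚ) + (count p + count p) * t ⇔ IsMatching F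
  extremal = kirchhoffIndex≡bound⇔isMatching F connected zero t t[N-2]≡1 unique

  bound≡B : + (n ∸ 1) / 1 + + (2 ℕ.* p) / suc m ≡ (count n - 1ℚ) + (count p + count p) * t
  bound≡B = cong₂ _+_
    (trans (/1-count (n ∸ 1)) (solve 1 (λ c → c := con 1ℚ :+ c :- con 1ℚ) refl (count (n ∸ 1))))
    -- `2 ℕ.* p` computes to `p ℕ.+ (p ℕ.+ 0)`, hence the final removal of a zero.
    (trans (/-count (2 ℕ.* p) m) (cong (_* t) (trans (count-+ p (p ℕ.+ 0))
      (cong (λ k → count p + count k) (ℕ.+-identityʳ p)))))
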